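{- Let $G$ be a finite simple connected graph with edges $e_1,\dots,e_m$. If $z$ is a critical point of the weighted tree number $\tau$ in the interior of $P(G)$, then $z$ is a global maximum for $\tau$ on $P(G)$. In particular, if $G$ is equiarboreal, then the unweighted graph $\underline{\omega}=(1,1,\dots,1)$ is a global maximum for $\tau$ on $P(G)$.
   Context: The weighted edge polytope is $P(G)=\{(x_1,\dots,x_m): x_j\ge 0,\ \sum_{j=1}^m x_j=m\}$; its interior consists of the points with all $x_j>0$. The weighted tree number is $\tau(x)=\sum_{T}\prod_{e_j\in T}x_j$, the sum being over all spanning trees $T$ of $G$. A point $z\in P(G)$ is critical for $\tau$ if the directional derivative of $\tau$ at $z$ vanishes in every direction $y\in\mathbf{R}^m$ with $\sum_j y_j=0$. An (unweighted) graph $G$ is equiarboreal if every edge of $G$ is contained in the same number of spanning trees of $G$. -}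

module Defs where

open import Data.Bool using (if_then_else_)
open import Data.Fin as Fin using (Fin; zero; suc)
import Data.Fin.Properties as Fin
open import Data.Fin.Subset using (Subset; inside; outside; _∈_; ⊤)
open import Data.Fin.Subset.Properties using (_∈?_)
open import Data.Integer using (+_)
open import Data.List as List using (List; filter; length)
open import Data.Nat as ℕ using (ℕ; zero; suc)
import Data.Nat.Properties as ℕ
open import Data.Product using (∃; _×_; _,_; proj₁; proj₂)
open import Data.Product.Properties using (≡-dec)
open import Data.Rational as ℚ using (ℚ; 0ℚ; 1ℚ; ½)
import Data.Rational.Properties as ℚ
open import Data.Rational.Solver using (module +-*-Solver)
open import Data.Sum using (_⊎_; inj₁; inj₂)
open import Data.Vec as Vec using (Vec; []; _∷_; lookup; here; there)
open import Data.Vec.Functional as Vector using (Vector)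
open import Data.Vec.Relation.Unary.Linked as Linked using (Linked)
import Data.Vec.Relation.Unary.Unique.Propositional.Properties as Unique
open import Data.Vec.Relation.Unary.AllPairs using (allPairs?)
open import Data.Vec.Relation.Unary.Unique.Propositional using (Unique)
open import Function using (_∘_; Injective)
open import Level using (0ℓ)
open import Relation.Binary using (Rel)
open import Relation.Binary.Construct.Closure.ReflexiveTransitive as Star
  using (Star; _◅_; _◅◅_)
open import Relation.Binary.PropositionalEquality
open import Relation.Nullary
open import Relation.Nullary.Decidable using (map′)
open import Relation.Unary using (Pred; Decidable)

-- The real numbers: Cauchy sequences of rationals, with pointwise
-- operations and the equivalence _≈_ as equality.

EventuallyWithin : ℚ → (ℕ → ℚ) → Set
EventuallyWithin ε s =
  ∃ λ N → ∀ i j → N ℕ.≤ i → N ℕ.≤ j → ℚ.∣ s i ℚ.- s j ∣ ℚ.< ε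

IsCauchy : (ℕ → ℚ) → Set
IsCauchy s = ∀ ε → 0ℚ ℚ.< ε → EventuallyWithin ε s

record ℝ : Set where
  constructor mkℝ
  field
    seq    : ℕ → ℚ
    cauchy : IsCauchy seq

open ℝ public

module CauchyLemmas where

  half-pos : ∀ {ε} → 0ℚ ℚ.< ε → 0ℚ ℚ.< ½ ℚ.* ε
  half-pos {ε} 0<ε = subst (ℚ._< ½ ℚ.* ε) (ℚ.*-zeroʳ ½) (ℚ.*-monoʳ-<-pos ½ 0<ε)

  halves : ∀ ε → ½ ℚ.* ε ℚ.+ ½ ℚ.* ε ≡ ε
  halves ε = trans (sym (ℚ.*-distribʳ-+ ε ½ ½)) (ℚ.*-identityˡ ε)

  const-cauchy : ∀ q → IsCauchy (λ _ → q)
  const-cauchy q ε 0<ε = 0 , λ _ _ _ _ →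
    subst (ℚ._< ε) (cong ℚ.∣_∣ (sym (ℚ.+-inverseʳ q))) 0<ε

  +-cauchy : ∀ s t → IsCauchy s → IsCauchy t → IsCauchy (λ i → s i ℚ.+ t i)
  +-cauchy s t cs ct ε 0<ε
    with cs (½ ℚ.* ε) (half-pos 0<ε) | ct (½ ℚ.* ε) (half-pos 0<ε)
  ... | M , hs | N , ht = M ℕ.⊔ N , λ i j ≤i ≤j → begin-strict
    ℚ.∣ (s i ℚ.+ t i) ℚ.- (s j ℚ.+ t j) ∣
      ≡⟨ cong ℚ.∣_∣ (rearrange (s i) (t i) (s j) (t j)) ⟩
    ℚ.∣ (s i ℚ.- s j) ℚ.+ (t i ℚ.- t j) ∣
      ≤⟨ ℚ.∣p+q∣≤∣p∣+∣q∣ (s i ℚ.- s j) (t i ℚ.- t j) ⟩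
    ℚ.∣ s i ℚ.- s j ∣ ℚ.+ ℚ.∣ t i ℚ.- t j ∣
      <⟨ ℚ.+-mono-< (hs i j (ℕ.m⊔n≤o⇒m≤o M N ≤i) (ℕ.m⊔n≤o⇒m≤o M N ≤j))
                    (ht i j (ℕ.m⊔n≤o⇒n≤o M N ≤i) (ℕ.m⊔n≤o⇒n≤o M N ≤j)) ⟩
    ½ ℚ.* ε ℚ.+ ½ ℚ.* ε
      ≡⟨ halves ε ⟩
    ε ∎
    where
    open ℚ.≤-Reasoning
    open +-*-Solver
    rearrange : ∀ a b c d → (a ℚ.+ b) ℚ.- (c ℚ.+ d) ≡ (a ℚ.- c) ℚ.+ (b ℚ.- d)
    rearrange = solve 4 (λ a b c d →
      (a :+ b) :- (c :+ d) := (a :- c) :+ (b :- d)) refl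

  neg-cauchy : ∀ s → IsCauchy s → IsCauchy (λ i → ℚ.- s i)
  neg-cauchy s cs ε 0<ε with cs ε 0<ε
  ... | N , h = N , λ i j ≤i ≤j →
    subst (ℚ._< ε) (trans (sym (ℚ.∣-p∣≡∣p∣ (s i ℚ.- s j)))
                          (cong ℚ.∣_∣ (ℚ.neg-distrib-+ (s i) (ℚ.- s j))))
          (h i j ≤i ≤j)

  ∣∣-step : ∀ p q → ℚ.∣ p ∣ ℚ.≤ ℚ.∣ p ℚ.- q ∣ ℚ.+ ℚ.∣ q ∣
  ∣∣-step p q = subst (λ r → ℚ.∣ r ∣ ℚ.≤ ℚ.∣ p ℚ.- q ∣ ℚ.+ ℚ.∣ q ∣)
    (solve 2 (λ p q → (p :- q) :+ q := p) refl p q)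
    (ℚ.∣p+q∣≤∣p∣+∣q∣ (p ℚ.- q) q)
    where open +-*-Solver

  ∣∣-diff : ∀ p q → ℚ.∣ p ∣ ℚ.- ℚ.∣ q ∣ ℚ.≤ ℚ.∣ p ℚ.- q ∣
  ∣∣-diff p q = begin
    ℚ.∣ p ∣ ℚ.- ℚ.∣ q ∣
      ≤⟨ ℚ.+-monoˡ-≤ (ℚ.- ℚ.∣ q ∣) (∣∣-step p q) ⟩
    (ℚ.∣ p ℚ.- q ∣ ℚ.+ ℚ.∣ q ∣) ℚ.- ℚ.∣ q ∣
      ≡⟨ solve 2 (λ a b → (a :+ b) :- b := a) refl ℚ.∣ p ℚ.- q ∣ ℚ.∣ q ∣ ⟩
    ℚ.∣ p ℚ.- q ∣ ∎
    where
    open ℚ.≤-Reasoning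
    open +-*-Solver

  swap-diff : ∀ p q → ℚ.- (p ℚ.- q) ≡ q ℚ.- p
  swap-diff = solve 2 (λ p q → :- (p :- q) := q :- p) refl
    where open +-*-Solver

  ∣∣-lipschitz : ∀ p q → ℚ.∣ ℚ.∣ p ∣ ℚ.- ℚ.∣ q ∣ ∣ ℚ.≤ ℚ.∣ p ℚ.- q ∣
  ∣∣-lipschitz p q with ℚ.∣p∣≡p∨∣p∣≡-p (ℚ.∣ p ∣ ℚ.- ℚ.∣ q ∣)
  ... | inj₁ eq = subst (ℚ._≤ ℚ.∣ p ℚ.- q ∣) (sym eq) (∣∣-diff p q)
  ... | inj₂ eq = subst₂ ℚ._≤_
    (sym (trans eq (swap-diff ℚ.∣ p ∣ ℚ.∣ q ∣)))
    (trans (sym (ℚ.∣-p∣≡∣p∣ (q ℚ.- p))) (cong ℚ.∣_∣ (swap-diff q p)))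
    (∣∣-diff q p)

  abs-cauchy : ∀ s → IsCauchy s → IsCauchy (λ i → ℚ.∣ s i ∣)
  abs-cauchy s cs ε 0<ε with cs ε 0<ε
  ... | N , h = N , λ i j ≤i ≤j →
    ℚ.≤-<-trans (∣∣-lipschitz (s i) (s j)) (h i j ≤i ≤j)

  EventuallyBounded : ℚ → (ℕ → ℚ) → Set
  EventuallyBounded B s = ∃ λ N → ∀ i → N ℕ.≤ i → ℚ.∣ s i ∣ ℚ.≤ B

  eventually-bounded : ∀ s → IsCauchy s → ∃ λ B → ℚ.Positive B × EventuallyBounded B s
  eventually-bounded s cs with cs 1ℚ (ℚ.positive⁻¹ 1ℚ)
  ... | N , h = 1ℚ ℚ.+ ℚ.∣ s N ∣
    , ℚ.pos+nonNeg⇒pos 1ℚ ℚ.∣ s N ∣ {{ℚ.∣-∣-nonNeg (s N)}}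
    , N , λ i ≤i → ℚ.≤-trans (∣∣-step (s i) (s N))
        (ℚ.+-monoˡ-≤ ℚ.∣ s N ∣ (ℚ.<⇒≤ (h i N ≤i ℕ.≤-refl)))

  shrink : ∀ B → ℚ.Positive B → ∀ ε → 0ℚ ℚ.< ε →
    ∃ λ δ → 0ℚ ℚ.< δ × B ℚ.* δ ≡ ε
  shrink B B>0 ε 0<ε =
    (ℚ.1/ B) ℚ.* ε
    , subst (ℚ._< (ℚ.1/ B) ℚ.* ε) (ℚ.*-zeroʳ (ℚ.1/ B)) (ℚ.*-monoʳ-<-pos (ℚ.1/ B) 0<ε)
    , trans (sym (ℚ.*-assoc B (ℚ.1/ B) ε))
        (trans (cong (ℚ._* ε) (ℚ.*-inverseʳ B)) (ℚ.*-identityˡ ε))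
    where
    instance
      posB : ℚ.Positive B
      posB = B>0
      nzB : ℚ.NonZero B
      nzB = ℚ.pos⇒nonZero B
      pos1/B : ℚ.Positive (ℚ.1/ B)
      pos1/B = ℚ.1/pos⇒pos B

  *-bound : ∀ {a b p q} → ℚ.Positive b → ℚ.∣ p ∣ ℚ.≤ b → ℚ.∣ q ∣ ℚ.< a →
    ℚ.∣ p ℚ.* q ∣ ℚ.< b ℚ.* a
  *-bound {a} {b} {p} {q} b>0 p≤b q<a = begin-strict
    ℚ.∣ p ℚ.* q ∣         ≡⟨ ℚ.∣p*q∣≡∣p∣*∣q∣ p q ⟩
    ℚ.∣ p ∣ ℚ.* ℚ.∣ q ∣   ≤⟨ ℚ.*-monoʳ-≤-nonNeg ℚ.∣ q ∣ {{ℚ.∣-∣-nonNeg q}} p≤b ⟩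
    b ℚ.* ℚ.∣ q ∣         <⟨ ℚ.*-monoʳ-<-pos b {{b>0}} q<a ⟩
    b ℚ.* a               ∎
    where open ℚ.≤-Reasoning

  *-estimate : ∀ {A α B β} a b c d → ℚ.Positive A → ℚ.Positive B →
    ℚ.∣ a ∣ ℚ.≤ A → ℚ.∣ b ℚ.- d ∣ ℚ.< α → ℚ.∣ d ∣ ℚ.≤ B → ℚ.∣ a ℚ.- c ∣ ℚ.< β →
    ℚ.∣ a ℚ.* b ℚ.- c ℚ.* d ∣ ℚ.< A ℚ.* α ℚ.+ B ℚ.* β
  *-estimate {A} {α} {B} {β} a b c d A>0 B>0 a≤ bd< d≤ ac< = begin-strict
    ℚ.∣ a ℚ.* b ℚ.- c ℚ.* d ∣
      ≡⟨ cong ℚ.∣_∣ (rearrange a b c d) ⟩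
    ℚ.∣ a ℚ.* (b ℚ.- d) ℚ.+ d ℚ.* (a ℚ.- c) ∣
      ≤⟨ ℚ.∣p+q∣≤∣p∣+∣q∣ (a ℚ.* (b ℚ.- d)) (d ℚ.* (a ℚ.- c)) ⟩
    ℚ.∣ a ℚ.* (b ℚ.- d) ∣ ℚ.+ ℚ.∣ d ℚ.* (a ℚ.- c) ∣
      <⟨ ℚ.+-mono-< (*-bound {α} {A} {a} {b ℚ.- d} A>0 a≤ bd<)
                    (*-bound {β} {B} {d} {a ℚ.- c} B>0 d≤ ac<) ⟩
    A ℚ.* α ℚ.+ B ℚ.* β ∎
    where
    open ℚ.≤-Reasoning
    open +-*-Solver
    rearrange : ∀ a b c d →
      a ℚ.* b ℚ.- c ℚ.* d ≡ a ℚ.* (b ℚ.- d) ℚ.+ d ℚ.* (a ℚ.- c)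
    rearrange = solve 4 (λ a b c d →
      a :* b :- c :* d := a :* (b :- d) :+ d :* (a :- c)) refl

  ⊔-split : ∀ M N {i} → M ℕ.⊔ N ℕ.≤ i → M ℕ.≤ i × N ℕ.≤ i
  ⊔-split M N h = ℕ.m⊔n≤o⇒m≤o M N h , ℕ.m⊔n≤o⇒n≤o M N h

  *-within : ∀ {A α B β} s t → ℚ.Positive A → ℚ.Positive B →
    EventuallyBounded A s → EventuallyBounded B t →
    EventuallyWithin α t → EventuallyWithin β s →
    EventuallyWithin (A ℚ.* α ℚ.+ B ℚ.* β) (λ i → s i ℚ.* t i)
  *-within s t A>0 B>0 (M₁ , hA) (M₂ , hB) (M₃ , ht) (M₄ , hs) =
    (M₁ ℕ.⊔ M₂) ℕ.⊔ (M₃ ℕ.⊔ M₄) , λ i j ≤i ≤j →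
      *-estimate (s i) (t i) (s j) (t j) A>0 B>0
        (hA i (proj₁ (≤₁₂ ≤i)))
        (ht i j (proj₁ (≤₃₄ ≤i)) (proj₁ (≤₃₄ ≤j)))
        (hB j (proj₂ (≤₁₂ ≤j)))
        (hs i j (proj₂ (≤₃₄ ≤i)) (proj₂ (≤₃₄ ≤j)))
    where
    N = (M₁ ℕ.⊔ M₂) ℕ.⊔ (M₃ ℕ.⊔ M₄)
    ≤₁₂ : ∀ {i} → N ℕ.≤ i → M₁ ℕ.≤ i × M₂ ℕ.≤ i
    ≤₁₂ h = ⊔-split M₁ M₂ (proj₁ (⊔-split (M₁ ℕ.⊔ M₂) (M₃ ℕ.⊔ M₄) h))
    ≤₃₄ : ∀ {i} → N ℕ.≤ i → M₃ ℕ.≤ i × M₄ ℕ.≤ i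
    ≤₃₄ h = ⊔-split M₃ M₄ (proj₂ (⊔-split (M₁ ℕ.⊔ M₂) (M₃ ℕ.⊔ M₄) h))

  *-cauchy : ∀ s t → IsCauchy s → IsCauchy t → IsCauchy (λ i → s i ℚ.* t i)
  *-cauchy s t cs ct ε 0<ε =
    go (eventually-bounded s cs) (eventually-bounded t ct)
    where
    Bound : (ℕ → ℚ) → Set
    Bound u = ∃ λ B → ℚ.Positive B × EventuallyBounded B u
    Shrunk : ℚ → Set
    Shrunk B = ∃ λ δ → 0ℚ ℚ.< δ × B ℚ.* δ ≡ ½ ℚ.* ε
    P : ℚ → Set
    P η = EventuallyWithin η (λ i → s i ℚ.* t i)
    go′ : ∀ {A B} → ℚ.Positive A → ℚ.Positive B →
          EventuallyBounded A s → EventuallyBounded B t →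
          Shrunk A → Shrunk B → P ε
    go′ A>0 B>0 hA hB (α , 0<α , Aα) (β , 0<β , Bβ) =
      subst P (trans (cong₂ ℚ._+_ Aα Bβ) (halves ε))
        (*-within s t A>0 B>0 hA hB (ct α 0<α) (cs β 0<β))
    go : Bound s → Bound t → P ε
    go (A , A>0 , hA) (B , B>0 , hB) = go′ A>0 B>0 hA hB
      (shrink A A>0 (½ ℚ.* ε) (half-pos 0<ε))
      (shrink B B>0 (½ ℚ.* ε) (half-pos 0<ε))

open CauchyLemmas

infix  8 -_
infixl 7 _*_
infixl 6 _+_ _-_
infix  4 _≈_ _≤_ _<_

fromℚ : ℚ → ℝ
fromℚ q = mkℝ (λ _ → q) (const-cauchy q)

fromℕ : ℕ → ℝ
fromℕ n = fromℚ (+ n ℚ./ 1)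

0ℝ 1ℝ : ℝ
0ℝ = fromℚ 0ℚ
1ℝ = fromℚ 1ℚ

_+_ _*_ : ℝ → ℝ → ℝ
x + y = mkℝ (λ i → seq x i ℚ.+ seq y i) (+-cauchy (seq x) (seq y) (cauchy x) (cauchy y))
x * y = mkℝ (λ i → seq x i ℚ.* seq y i) (*-cauchy (seq x) (seq y) (cauchy x) (cauchy y))

-_ : ℝ → ℝ
- x = mkℝ (λ i → ℚ.- seq x i) (neg-cauchy (seq x) (cauchy x))

_-_ : ℝ → ℝ → ℝ
x - y = x + (- y)

∣_∣ : ℝ → ℝ
∣ x ∣ = mkℝ (λ i → ℚ.∣ seq x i ∣) (abs-cauchy (seq x) (cauchy x))

_≈_ _≤_ _<_ : Rel ℝ 0ℓ
x ≈ y = ∀ ε → 0ℚ ℚ.< ε → ∃ λ N → ∀ i → N ℕ.≤ i → ℚ.∣ seq x i ℚ.- seq y i ∣ ℚ.< ε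
x ≤ y = ∀ ε → 0ℚ ℚ.< ε → ∃ λ N → ∀ i → N ℕ.≤ i → seq x i ℚ.≤ seq y i ℚ.+ ε
x < y = ∃ λ ε → 0ℚ ℚ.< ε × ∃ λ N → ∀ i → N ℕ.≤ i → seq x i ℚ.+ ε ℚ.≤ seq y i

∑ ∏ : ∀ {m} → Vector ℝ m → ℝ
∑ = Vector.foldr _+_ 0ℝ
∏ = Vector.foldr _*_ 1ℝ

-- D_y f (z) = d, i.e. (f (z + t y) - f z) / t → d as t → 0, with the
-- difference quotient multiplied through by t.
HasDirectionalDerivative : ∀ {m} → (Vector ℝ m → ℝ) → Vector ℝ m → Vector ℝ m → ℝ → Set
HasDirectionalDerivative f z y d =
  ∀ ε → 0ℝ < ε → ∃ λ δ → 0ℝ < δ × (∀ t → 0ℝ < ∣ t ∣ → ∣ t ∣ < δ →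
    ∣ (f (λ j → z j + t * y j) - f z) - t * d ∣ < ε * ∣ t ∣)

-- The edge e_j is the two-element set {u , v} of vertices, stored as the
-- pair (u , v) with u < v; so there are no loops, and injectivity rules
-- out parallel edges.
record Graph : Set where
  field
    #V #E     : ℕ
    ends      : Fin #E → Fin #V × Fin #V
    ordered   : ∀ e → proj₁ (ends e) Fin.< proj₂ (ends e)
    injective : Injective _≡_ _≡_ ends

-- Adjacency in the spanning subgraph whose edge set is T.
Adj : ∀ {n m} → (Fin m → Fin n × Fin n) → Subset m → Rel (Fin n) 0ℓ
Adj ends T u v = ∃ λ e → e ∈ T × (ends e ≡ (u , v) ⊎ ends e ≡ (v , u))

module PathLemmas where

  module _ {n : ℕ} where

    adj? : ∀ {m} (ends : Fin m → Fin n × Fin n) T u v → Dec (Adj ends T u v)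
    adj? ends T u v = Fin.any? λ e →
      (e ∈? T) ×-dec ((ends e ≟² (u , v)) ⊎-dec (ends e ≟² (v , u)))
      where
      _≟²_ = ≡-dec (Fin._≟_ {n}) (Fin._≟_ {n})

    weaken : ∀ {m} {ends : Fin (suc m) → Fin n × Fin n} {s T u v} →
             Star (Adj (ends ∘ suc) T) u v → Star (Adj ends (s ∷ T)) u v
    weaken = Star.map λ (e , e∈T , eq) → suc e , there e∈T , eq

    -- Paths using the extra edge 0 can be taken to use it once.
    Split : ∀ {m} → (Fin (suc m) → Fin n × Fin n) → Subset m → Rel (Fin n) 0ℓ
    Split ends T u v =
      let a , b = ends zero ; P = Star (Adj (ends ∘ suc) T) in
      P u v ⊎ (P u a × P b v) ⊎ (P u b × P a v)

    split : ∀ {m} (ends : Fin (suc m) → Fin n × Fin n) T {u v} →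
            Star (Adj ends (inside ∷ T)) u v → Split ends T u v
    split ends T Star.ε = inj₁ Star.ε
    split ends T ((suc e , there e∈T , eq) ◅ p) with split ends T p
    ... | inj₁ q              = inj₁ ((e , e∈T , eq) ◅ q)
    ... | inj₂ (inj₁ (q , r)) = inj₂ (inj₁ ((e , e∈T , eq) ◅ q , r))
    ... | inj₂ (inj₂ (q , r)) = inj₂ (inj₂ ((e , e∈T , eq) ◅ q , r))
    split ends T ((zero , here , inj₁ eq) ◅ p) with ends zero | split ends T p
    split ends T ((zero , here , inj₁ refl) ◅ p) | _ | inj₁ q              = inj₂ (inj₁ (Star.ε , q))
    split ends T ((zero , here , inj₁ refl) ◅ p) | _ | inj₂ (inj₁ (q , r)) = inj₂ (inj₁ (Star.ε , r))
    split ends T ((zero , here , inj₁ refl) ◅ p) | _ | inj₂ (inj₂ (q , r)) = inj₁ r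
    split ends T ((zero , here , inj₂ eq) ◅ p) with ends zero | split ends T p
    split ends T ((zero , here , inj₂ refl) ◅ p) | _ | inj₁ q              = inj₂ (inj₂ (Star.ε , q))
    split ends T ((zero , here , inj₂ refl) ◅ p) | _ | inj₂ (inj₁ (q , r)) = inj₁ r
    split ends T ((zero , here , inj₂ refl) ◅ p) | _ | inj₂ (inj₂ (q , r)) = inj₂ (inj₂ (Star.ε , r))

    unsplit : ∀ {m} (ends : Fin (suc m) → Fin n × Fin n) T {u v} →
              Split ends T u v → Star (Adj ends (inside ∷ T)) u v
    unsplit ends T (inj₁ p)              = weaken p
    unsplit ends T (inj₂ (inj₁ (p , q))) =
      weaken p ◅◅ ((zero , here , inj₁ refl) ◅ weaken q)
    unsplit ends T (inj₂ (inj₂ (p , q))) =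
      weaken p ◅◅ ((zero , here , inj₂ refl) ◅ weaken q)

    path? : ∀ {m} (ends : Fin m → Fin n × Fin n) T u v → Dec (Star (Adj ends T) u v)
    path? {zero} ends T u v = map′ (λ { refl → Star.ε }) (λ { Star.ε → refl }) (u Fin.≟ v)
    path? {suc m} ends (outside ∷ T) u v =
      map′ weaken
           (Star.map λ { (suc e , there e∈T , eq) → e , e∈T , eq })
           (path? (ends ∘ suc) T u v)
    path? {suc m} ends (inside ∷ T) u v =
      let a , b = ends zero ; p? = path? (ends ∘ suc) T in
      map′ (unsplit ends T) (split ends T)
           (p? u v ⊎-dec ((p? u a ×-dec p? b v) ⊎-dec (p? u b ×-dec p? a v)))

  anyVec? : ∀ {n ℓ} k {P : Pred (Vec (Fin n) k) ℓ} → Decidable P → Dec (∃ P)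
  anyVec? zero    P? = map′ ([] ,_) (λ { ([] , p) → p }) (P? [])
  anyVec? (suc k) P? = map′ (λ (x , xs , p) → x ∷ xs , p)
                            (λ { (x ∷ xs , p) → x , xs , p })
                            (Fin.any? λ x → anyVec? k (P? ∘ (x ∷_)))

open PathLemmas

module _ (G : Graph) where
  open Graph G

  -- The empty graph is not connected.
  ConnectedSpanning : Subset #E → Set
  ConnectedSpanning T = 0 ℕ.< #V × (∀ u v → Star (Adj ends T) u v)

  IsCycle : Subset #E → ∀ {k} → Vec (Fin #V) (suc k) → Set
  IsCycle T {k} (v ∷ vs) =
    3 ℕ.≤ suc k × Unique (v ∷ vs) × Linked (Adj ends T) (v ∷ (vs Vec.∷ʳ v))

  Acyclic : Subset #E → Set
  Acyclic T = ∀ k (vs : Vec (Fin #V) (suc k)) → ¬ IsCycle T vs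

  IsSpanningTree : Subset #E → Set
  IsSpanningTree T = ConnectedSpanning T × Acyclic T

  private
    isCycle? : ∀ T {k} (vs : Vec (Fin #V) (suc k)) → Dec (IsCycle T vs)
    isCycle? T {k} (v ∷ vs) =
      (3 ℕ.≤? suc k) ×-dec
      (allPairs? (λ x y → ¬? (x Fin.≟ y)) (v ∷ vs) ×-dec
       Linked.linked? (adj? ends T) (v ∷ (vs Vec.∷ʳ v)))

    short : ∀ T {k} (vs : Vec (Fin #V) (suc k)) → IsCycle T vs → k ℕ.< #V
    short T (v ∷ vs) (_ , uniq , _) =
      Fin.injective⇒≤ {f = lookup (v ∷ vs)} (Unique.lookup-injective uniq _ _)

    acyclic? : ∀ T → Dec (Acyclic T)
    acyclic? T = map′
      (λ none k vs c → none (short T vs c) (vs , c))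
      (λ acyc {k} _ (vs , c) → acyc k vs c)
      (ℕ.allUpTo? (λ k → ¬? (anyVec? (suc k) (isCycle? T))) #V)

  isSpanningTree? : Decidable IsSpanningTree
  isSpanningTree? T =
    ((0 ℕ.<? #V) ×-dec Fin.all? (λ u → Fin.all? (path? ends T u)))
    ×-dec acyclic? T

subsets : ∀ m → List (Subset m)
subsets zero    = [] List.∷ List.[]
subsets (suc m) = List.map (outside ∷_) (subsets m) List.++ List.map (inside ∷_) (subsets m)

module _ (G : Graph) where
  open Graph G

  Connected : Set
  Connected = ConnectedSpanning G ⊤

  spanningTrees : List (Subset #E)
  spanningTrees = filter (isSpanningTree? G) (subsets #E)

  Equiarboreal : Set
  Equiarboreal = ∀ e f →
    length (filter (e ∈?_) spanningTrees) ≡ length (filter (f ∈?_) spanningTrees)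

  τ : Vector ℝ #E → ℝ
  τ x = List.foldr _+_ 0ℝ
    (List.map (λ T → ∏ (λ j → if lookup T j then x j else 1ℝ)) spanningTrees)

  EdgePolytope : Pred (Vector ℝ #E) 0ℓ
  EdgePolytope x = (∀ j → 0ℝ ≤ x j) × ∑ x ≈ fromℕ #E

  Interior : Pred (Vector ℝ #E) 0ℓ
  Interior x = EdgePolytope x × (∀ j → 0ℝ < x j)

  IsCritical : Pred (Vector ℝ #E) 0ℓ
  IsCritical z = EdgePolytope z ×
    (∀ y → ∑ y ≈ 0ℝ → HasDirectionalDerivative τ z y 0ℝ)

  IsGlobalMax : Pred (Vector ℝ #E) 0ℓ
  IsGlobalMax z = EdgePolytope z × (∀ x → EdgePolytope x → τ x ≤ τ z)

  ω : Vector ℝ #E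
  ω _ = 1ℝ

{-# OPTIONS --safe #-}

-- By the matrix-tree theorem τ(x) is a determinant of the quadratic form
-- h ↦ Σ x_e (h_a - h_b)², which is linear in x.  Diagonalising by completing
-- squares, each pivot is the minimum of the form over an affine subspace,
-- hence concave in x; so τ is midpoint log-concave: τ(x) τ(z) ≤ τ((x + z)/2)².
-- Halving the segment from x to z repeatedly, τ(x) > τ(z) would force τ to
-- grow at a positive rate when leaving z towards x, contradicting criticality.
-- All of this takes place in ℚ, at a late enough index of the Cauchy sequences.

module Submission where

open import Defs hiding (_+_; _*_; _-_; -_; ∣_∣; _≤_; _<_; _≈_)
import Defs as ℝ
open import Data.Bool using (Bool; true; false; if_then_else_)
open import Data.Fin as Fin using (Fin; zero; suc)
import Data.Fin.Properties as Fin
open import Data.Fin.Subset as Subset using (Subset; inside; outside; _∈_)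
import Data.Fin.Subset.Properties as Subset
import Data.Integer as ℤ
import Data.Integer.Properties as ℤ
open import Data.List as List using (List; filter; length; _++_)
import Data.List.Properties as List
import Data.List.Relation.Unary.All as ListAll
open import Data.Nat as ℕ using (ℕ; zero; suc; z≤n; s≤s)
import Data.Nat.Coprimality as Coprime
import Data.Nat.Properties as ℕ
open import Data.Product as Product using (Σ; ∃; _×_; _,_; proj₁; proj₂)
open import Data.Rational
open import Data.Rational.Properties
open import Data.Rational.Solver using (module +-*-Solver)
open import Data.Sum as Sum using (_⊎_; inj₁; inj₂; [_,_]′)
open import Data.Vec as Vec using (Vec; []; _∷_; here; there; lookup)
import Data.Vec.Properties as Vec
open import Data.Vec.Functional as Vector using (Vector)
open import Data.Vec.Relation.Unary.All using (All; []; _∷_)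
open import Data.Vec.Relation.Unary.AllPairs using ([]; _∷_)
open import Data.Vec.Relation.Unary.Linked using (Linked; [-]; _∷_)
open import Data.Vec.Relation.Unary.Unique.Propositional using (Unique)
open import Function using (_∘_; _⇔_; mk⇔; Equivalence)
import Function.Properties.Equivalence as ⇔
open import Level using (0ℓ)
open import Relation.Binary using (Rel)
open import Relation.Binary.Construct.Closure.ReflexiveTransitive as Star
  using (Star; _◅_; _◅◅_)
open import Relation.Binary.PropositionalEquality
open import Relation.Nullary using (¬_; Dec; yes; no; contradiction)
open import Relation.Nullary.Decidable using (toWitness)
open import Relation.Unary using (Pred; Decidable)

open +-*-Solver using (solve; con; _:=_; _:+_; _:*_; _:-_; :-_)
open CauchyLemmas using (eventually-bounded; shrink; half-pos; halves; ⊔-split)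
open PathLemmas using (weaken; split)

-- A determinant here is nothing but a product of pivots. That it does not depend on the
-- factorisation follows by comparing values of forms (`det-unique`), and the same argument
-- identifies a contracted Laplacian with the Laplacian of the merged graph, without matrix algebra.
-- Pivots may vanish, since weights may be 0 and disconnected graphs occur in the induction; hence
-- the elimination identities are stated free of division.
--
-- The matrix-tree theorem is proved by deletion and contraction. Contraction creates loops and
-- parallel edges, so the induction runs over arbitrary endpoint maps, and trees are counted by
-- edges instead of tested for cycles.
--
-- Rational samples are the other obstacle: those of a nonnegative real may be negative, and those
-- of a point of the polytope need not sum to m. So `x` is replaced by its absolute value and every
-- estimate holds only eventually, with constants fixed before the index. The descent consumes a
-- one-sided bound, `NoAscent`; a critical point yields it from its derivative, an equiarboreal
-- graph from a first-order expansion at `ω`.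

private variable
  n m r : ℕ

-- Quadratic forms as sums of squares

*-nonneg : ∀ {p q} → 0ℚ ≤ p → 0ℚ ≤ q → 0ℚ ≤ p * q
*-nonneg {p} {q} 0≤p 0≤q =
  nonNegative⁻¹ (p * q) {{nonNeg*nonNeg⇒nonNeg p {{nonNegative 0≤p}} q {{nonNegative 0≤q}}}}

+-nonneg : ∀ {p q} → 0ℚ ≤ p → 0ℚ ≤ q → 0ℚ ≤ p + q
+-nonneg = +-mono-≤

*-mono-≤-nonneg : ∀ {p q u v} → 0ℚ ≤ p → 0ℚ ≤ v → p ≤ q → u ≤ v → p * u ≤ q * v
*-mono-≤-nonneg {p} {q} {u} {v} 0≤p 0≤v p≤q u≤v = ≤-trans
  (*-monoˡ-≤-nonNeg p {{nonNegative 0≤p}} u≤v)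
  (*-monoʳ-≤-nonNeg v {{nonNegative 0≤v}} p≤q)

sq : ℚ → ℚ
sq p = p * p

sq-nonneg : ∀ p → 0ℚ ≤ sq p
sq-nonneg p with ≤-total 0ℚ p
... | inj₁ 0≤p = *-nonneg 0≤p 0≤p
... | inj₂ p≤0 = subst (0ℚ ≤_) (solve 1 (λ p → (:- p) :* (:- p) := p :* p) refl p)
  (*-nonneg (neg-antimono-≤ p≤0) (neg-antimono-≤ p≤0))

infix 8 _∙_

_∙_ : Vec ℚ n → Vec ℚ n → ℚ
[]      ∙ []      = 0ℚ
(a ∷ α) ∙ (h ∷ η) = a * h + α ∙ η

comb : ℚ → Vec ℚ n → ℚ → Vec ℚ n → Vec ℚ n
comb p α q β = Vec.zipWith (λ a b → p * a + q * b) α β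

0s : Vec ℚ n
0s = Vec.replicate _ 0ℚ

comb-∙ : ∀ p (α : Vec ℚ n) q β h → comb p α q β ∙ h ≡ p * (α ∙ h) + q * (β ∙ h)
comb-∙ p []      q []      []      = sym (cong₂ _+_ (*-zeroʳ p) (*-zeroʳ q))
comb-∙ p (a ∷ α) q (b ∷ β) (h ∷ η) = trans
  (cong (((p * a + q * b) * h) +_) (comb-∙ p α q β η))
  (solve 7 (λ p a q b h u v →
     (p :* a :+ q :* b) :* h :+ (p :* u :+ q :* v) := p :* (a :* h :+ u) :+ q :* (b :* h :+ v))
     refl p a q b h (α ∙ η) (β ∙ η))

comb-0-1 : ∀ (α β : Vec ℚ n) → comb 0ℚ α 1ℚ β ≡ β
comb-0-1 []      []      = refl
comb-0-1 (a ∷ α) (b ∷ β) = cong₂ _∷_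
  (solve 2 (λ a b → con 0ℚ :* a :+ con 1ℚ :* b := b) refl a b) (comb-0-1 α β)

∙-0s : (α : Vec ℚ n) → α ∙ 0s ≡ 0ℚ
∙-0s []      = refl
∙-0s (a ∷ α) = cong₂ _+_ (*-zeroʳ a) (∙-0s α)

0s-∙ : (h : Vec ℚ n) → 0s ∙ h ≡ 0ℚ
0s-∙ []      = refl
0s-∙ (h ∷ η) = cong₂ _+_ (*-zeroˡ h) (0s-∙ η)

-- An LDLᵀ factorisation of a positive semidefinite form: `d` is the pivot, `α` the row of the unit
-- triangular factor. Admitting `d = 0` keeps singular forms in the type.
data Form : ℕ → Set where
  []    : Form 0
  pivot : (d : ℚ) → 0ℚ ≤ d → Vec ℚ r → Form r → Form (suc r)

⟦_⟧ : Form r → Vec ℚ r → ℚ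
⟦ [] ⟧            h       = 0ℚ
⟦ pivot d _ α F ⟧ (h ∷ η) = d * sq (h + α ∙ η) + ⟦ F ⟧ η

det : Form r → ℚ
det []              = 1ℚ
det (pivot d _ _ F) = d * det F

det-nonneg : (F : Form r) → 0ℚ ≤ det F
det-nonneg []                = nonNegative⁻¹ 1ℚ
det-nonneg (pivot d 0≤d _ F) = *-nonneg 0≤d (det-nonneg F)

⟦⟧-0s : (F : Form r) → ⟦ F ⟧ 0s ≡ 0ℚ
⟦⟧-0s []              = refl
⟦⟧-0s (pivot d _ α F) = trans
  (cong₂ (λ u v → d * sq (0ℚ + u) + v) (∙-0s α) (⟦⟧-0s F))
  (solve 1 (λ d → d :* con 0ℚ :+ con 0ℚ := con 0ℚ) refl d)

⟦⟧-e₀ : ∀ d 0≤d α (F : Form r) → ⟦ pivot d 0≤d α F ⟧ (1ℚ ∷ 0s) ≡ d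
⟦⟧-e₀ d _ α F = trans
  (cong₂ (λ u v → d * sq (1ℚ + u) + v) (∙-0s α) (⟦⟧-0s F))
  (solve 1 (λ d → d :* con 1ℚ :+ con 0ℚ := d) refl d)

⟦⟧-drop : ∀ d 0≤d α (F : Form r) h η → ⟦ F ⟧ η ≤ ⟦ pivot d 0≤d α F ⟧ (h ∷ η)
⟦⟧-drop d 0≤d α F h η = subst (_≤ ⟦ pivot d 0≤d α F ⟧ (h ∷ η)) (+-identityˡ (⟦ F ⟧ η))
  (+-monoˡ-≤ (⟦ F ⟧ η) (*-nonneg 0≤d (sq-nonneg (h + α ∙ η))))

-- The first coordinate `- (α ∙ η)` kills the square. With `⟦⟧-drop` this makes `F` the minimum of
-- the whole form over its first coordinate.
⟦⟧-harmonic : ∀ d 0≤d α (F : Form r) η → ⟦ pivot d 0≤d α F ⟧ (- (α ∙ η) ∷ η) ≡ ⟦ F ⟧ η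
⟦⟧-harmonic d _ α F η =
  solve 3 (λ d a f → d :* ((:- a :+ a) :* (:- a :+ a)) :+ f := f) refl d (α ∙ η) (⟦ F ⟧ η)

-- The value at the first basis vector compares the pivots. For the rest, the minimising coordinate
-- of `B` is admissible for `A`, so the minimum of `A` is at most that of `B`.
det-mono : (A B : Form r) → (∀ h → ⟦ A ⟧ h ≤ ⟦ B ⟧ h) → det A ≤ det B
det-mono [] [] _ = ≤-refl
det-mono (pivot a 0≤a α A) (pivot b 0≤b β B) A≤B = *-mono-≤-nonneg 0≤a (det-nonneg B)
  (subst₂ _≤_ (⟦⟧-e₀ a 0≤a α A) (⟦⟧-e₀ b 0≤b β B) (A≤B (1ℚ ∷ 0s)))
  (det-mono A B λ η → ≤-trans (⟦⟧-drop a 0≤a α A (- (β ∙ η)) η)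
    (subst (⟦ pivot a 0≤a α A ⟧ (- (β ∙ η) ∷ η) ≤_) (⟦⟧-harmonic b 0≤b β B η) (A≤B (- (β ∙ η) ∷ η))))

-- Makes `det` an invariant of the quadratic form, although the rows `α` are not unique when a pivot
-- vanishes.
det-unique : (A B : Form r) → (∀ h → ⟦ A ⟧ h ≡ ⟦ B ⟧ h) → det A ≡ det B
det-unique A B A≡B = ≤-antisym (det-mono A B (≤-reflexive ∘ A≡B)) (det-mono B A (≤-reflexive ∘ sym ∘ A≡B))

p≤q⇒0≤q-p : ∀ {p q} → p ≤ q → 0ℚ ≤ q - p
p≤q⇒0≤q-p {p} {q} p≤q = subst (_≤ q - p) (+-inverseʳ p) (+-monoˡ-≤ (- p) p≤q)

0≤q-p⇒p≤q : ∀ {p q} → 0ℚ ≤ q - p → p ≤ q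
0≤q-p⇒p≤q {p} {q} h = subst₂ _≤_ (+-identityˡ p)
  (solve 2 (λ p q → q :- p :+ p := q) refl p q) (+-monoˡ-≤ p h)

≤-by : ∀ {p q} d → 0ℚ ≤ d → q - p ≡ d → p ≤ q
≤-by d 0≤d eq = 0≤q-p⇒p≤q (subst (0ℚ ≤_) (sym eq) 0≤d)

am-gm : ∀ {a b c} → 0ℚ ≤ a → 0ℚ ≤ b → 0ℚ ≤ c → a + b ≤ c + c → a * b ≤ c * c
am-gm {a} {b} {c} 0≤a 0≤b 0≤c a+b≤2c = ≤-trans
  (≤-by (sq (½ * (a - b))) (sq-nonneg (½ * (a - b)))
    (solve 2 (λ a b → con ½ :* (a :+ b) :* (con ½ :* (a :+ b)) :- a :* b
                   := con ½ :* (a :- b) :* (con ½ :* (a :- b))) refl a b))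
  (*-mono-≤-nonneg 0≤half 0≤c half≤c half≤c)
  where
  0≤half : 0ℚ ≤ ½ * (a + b)
  0≤half = *-nonneg (nonNegative⁻¹ ½) (+-nonneg 0≤a 0≤b)
  half≤c : ½ * (a + b) ≤ c
  half≤c = subst (½ * (a + b) ≤_) (solve 1 (λ c → con ½ :* (c :+ c) := c) refl c)
    (*-monoˡ-≤-nonNeg ½ a+b≤2c)

-- The harmonic extension of η for C is merely an admissible one for A and B.
det-log-concave : (A B C : Form r) → (∀ h → ⟦ A ⟧ h + ⟦ B ⟧ h ≤ ⟦ C ⟧ h + ⟦ C ⟧ h) →
  det A * det B ≤ det C * det C
det-log-concave [] [] [] _ = ≤-refl
det-log-concave (pivot a 0≤a α A) (pivot b 0≤b β B) (pivot c 0≤c γ C) A+B≤2C =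
  subst₂ _≤_ (interchange a b (det A) (det B)) (interchange c c (det C) (det C))
    (*-mono-≤-nonneg (*-nonneg 0≤a 0≤b) (*-nonneg (det-nonneg C) (det-nonneg C))
      (am-gm 0≤a 0≤b 0≤c (subst₂ _≤_
        (cong₂ _+_ (⟦⟧-e₀ a 0≤a α A) (⟦⟧-e₀ b 0≤b β B))
        (cong₂ _+_ (⟦⟧-e₀ c 0≤c γ C) (⟦⟧-e₀ c 0≤c γ C)) (A+B≤2C (1ℚ ∷ 0s))))
      (det-log-concave A B C λ η → ≤-trans
        (+-mono-≤ (⟦⟧-drop a 0≤a α A (- (γ ∙ η)) η) (⟦⟧-drop b 0≤b β B (- (γ ∙ η)) η))
        (subst₂ _≤_ refl (cong₂ _+_ (⟦⟧-harmonic c 0≤c γ C η) (⟦⟧-harmonic c 0≤c γ C η))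
          (A+B≤2C (- (γ ∙ η) ∷ η)))))
  where
  interchange : ∀ p q u v → p * q * (u * v) ≡ p * u * (q * v)
  interchange = solve 4 (λ p q u v → p :* q :* (u :* v) := p :* u :* (q :* v)) refl

-- d (h + A)² + x (c h + L)² = s (h + p A + q L)² + y (L - c A)², identically in
-- h, A and L; αα, αℓ and ℓℓ compare the coefficients of A², A L and L².
record Elimination (d x c : ℚ) : Set where
  field
    s p q y : ℚ
    0≤s     : 0ℚ ≤ s
    0≤y     : 0ℚ ≤ y
    s≡      : s ≡ d + x * (c * c)
    sp≡     : s * p ≡ d
    sq≡     : s * q ≡ x * c
    sy≡     : s * y ≡ x * d
    αα      : d * p + y * (c * c) ≡ d
    αℓ      : d * q ≡ y * c
    ℓℓ      : x * c * q + y ≡ x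

eliminate : ∀ {d x} c → 0ℚ ≤ d → 0ℚ ≤ x → Elimination d x c
eliminate {d} {x} c 0≤d 0≤x with d + x * (c * c) ≟ 0ℚ
-- Two nonnegative terms sum to 0, so both vanish and so does `x * c`. The first coordinate then
-- drops out, and the update passes unchanged to the rest (`y = x`).
... | yes s≡0 = record
  { s = 0ℚ ; p = 1ℚ ; q = 0ℚ ; y = x ; 0≤s = ≤-refl ; 0≤y = 0≤x
  ; s≡ = sym s≡0
  ; sp≡ = sym d≡0
  ; sq≡ = sym xc≡0
  ; sy≡ = trans (*-zeroˡ x) (sym (trans (cong (x *_) d≡0) (*-zeroʳ x)))
  ; αα = trans (cong₂ _+_ (*-identityʳ d) xcc≡0) (+-identityʳ d)
  ; αℓ = trans (*-zeroʳ d) (sym xc≡0)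
  ; ℓℓ = trans (cong (_+ x) (*-zeroʳ (x * c))) (+-identityˡ x)
  }
  where
  0≤xcc = *-nonneg 0≤x (sq-nonneg c)
  d≡0 : d ≡ 0ℚ
  d≡0 = ≤-antisym (subst₂ _≤_ (+-identityʳ d) s≡0 (+-monoʳ-≤ d 0≤xcc)) 0≤d
  xcc≡0 : x * (c * c) ≡ 0ℚ
  xcc≡0 = ≤-antisym (subst₂ _≤_ (+-identityˡ _) s≡0 (+-monoˡ-≤ (x * (c * c)) 0≤d)) 0≤xcc
  xc≡0 : x * c ≡ 0ℚ
  xc≡0 with c ≟ 0ℚ
  ... | yes c≡0 = trans (cong (x *_) c≡0) (*-zeroʳ x)
  ... | no  c≢0 = *-cancelʳ-≡0 (trans (*-assoc x c c) xcc≡0)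
    where
    *-cancelʳ-≡0 : x * c * c ≡ 0ℚ → x * c ≡ 0ℚ
    *-cancelʳ-≡0 eq = begin
      x * c                   ≡⟨ *-identityʳ (x * c) ⟨
      x * c * 1ℚ              ≡⟨ cong (x * c *_) (*-inverseʳ c {{≢-nonZero c≢0}}) ⟨
      x * c * (c * 1/c)       ≡⟨ *-assoc (x * c) c 1/c ⟨
      x * c * c * 1/c         ≡⟨ cong (_* 1/c) eq ⟩
      0ℚ * 1/c                ≡⟨ *-zeroˡ 1/c ⟩
      0ℚ                      ∎
      where
      open ≡-Reasoning
      1/c = 1/_ c {{≢-nonZero c≢0}}
... | no s≢0 = record
  { s = s ; p = i * d ; q = i * (x * c) ; y = i * (x * d)
  ; 0≤s = 0≤s
  ; 0≤y = *-nonneg (<⇒≤ (positive⁻¹ i {{1/pos⇒pos s {{nonNeg∧nonZero⇒pos s {{nonNegative 0≤s}} {{s≠0}}}}}}))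
                   (*-nonneg 0≤x 0≤d)
  ; s≡ = refl
  ; sp≡ = cancel d
  ; sq≡ = cancel (x * c)
  ; sy≡ = cancel (x * d)
  ; αα = trans (solve 4 (λ i d x c → d :* (i :* d) :+ i :* (x :* d) :* (c :* c)
                  := (d :+ x :* (c :* c)) :* (i :* d)) refl i d x c) (cancel d)
  ; αℓ = solve 4 (λ i d x c → d :* (i :* (x :* c)) := i :* (x :* d) :* c) refl i d x c
  ; ℓℓ = trans (solve 4 (λ i d x c → x :* c :* (i :* (x :* c)) :+ i :* (x :* d)
                  := (d :+ x :* (c :* c)) :* (i :* x)) refl i d x c) (cancel x)
  }
  where
  s = d + x * (c * c)
  0≤s = +-nonneg 0≤d (*-nonneg 0≤x (sq-nonneg c))
  s≠0 : NonZero s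
  s≠0 = ≢-nonZero s≢0
  i = 1/_ s {{s≠0}}
  cancel : ∀ q → s * (i * q) ≡ q
  cancel q = trans (sym (*-assoc s i q))
    (trans (cong (_* q) (*-inverseʳ s {{s≠0}})) (*-identityˡ q))

-- Rank-one updates and the determinant lemma

-- Adds `x * sq (ℓ ∙ h)` to the form. Eliminating the first coordinate leaves a rank-one update of
-- `F` along `ℓ - c α` with weight `y`, whence the recursion.
update : Form r → ∀ x → 0ℚ ≤ x → Vec ℚ r → Form r
update []                x 0≤x []      = []
update (pivot d 0≤d α F) x 0≤x (c ∷ ℓ) =
  pivot s 0≤s (comb p α q ℓ) (update F y 0≤y (comb (- c) α 1ℚ ℓ))
  where open Elimination (eliminate c 0≤d 0≤x)

⟦⟧-update : ∀ (F : Form r) x 0≤x ℓ h → ⟦ update F x 0≤x ℓ ⟧ h ≡ ⟦ F ⟧ h + x * sq (ℓ ∙ h)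
⟦⟧-update []                x 0≤x []      []      = sym (trans (+-identityˡ (x * 0ℚ)) (*-zeroʳ x))
⟦⟧-update (pivot d 0≤d α F) x 0≤x (c ∷ ℓ) (h ∷ η) = begin
  s * sq (h + comb p α q ℓ ∙ η) + ⟦ update F y 0≤y (comb (- c) α 1ℚ ℓ) ⟧ η
    ≡⟨ cong (s * sq (h + comb p α q ℓ ∙ η) +_) (⟦⟧-update F y 0≤y _ η) ⟩
  s * sq (h + comb p α q ℓ ∙ η) + (f + y * sq (comb (- c) α 1ℚ ℓ ∙ η))
    ≡⟨ cong₂ (λ u v → s * sq (h + u) + (f + y * sq v)) (comb-∙ p α q ℓ η) (comb-∙ (- c) α 1ℚ ℓ η) ⟩
  s * sq (h + (p * A + q * L)) + (f + y * sq (- c * A + 1ℚ * L))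
    -- The solver cannot use the identities of `Elimination`, so the expression is sorted by
    -- monomials in `h`, `A`, `L`, and then each coefficient is rewritten separately.
    ≡⟨ solve 9 (λ s p q y h A L c f →
         s :* ((h :+ (p :* A :+ q :* L)) :* (h :+ (p :* A :+ q :* L)))
           :+ (f :+ y :* (((:- c) :* A :+ con 1ℚ :* L) :* ((:- c) :* A :+ con 1ℚ :* L)))
         := s :* (h :* h) :+ (s :* p) :* (con 2ℚ :* h :* A) :+ (s :* q) :* (con 2ℚ :* h :* L)
            :+ (s :* p :* p :+ y :* (c :* c)) :* (A :* A)
            :+ (s :* p :* q :- y :* c) :* (con 2ℚ :* A :* L)
            :+ (s :* q :* q :+ y) :* (L :* L) :+ f)
         refl s p q y h A L c f ⟩
  expanded s (s * p) (s * q) (s * p * p + y * (c * c)) (s * p * q - y * c) (s * q * q + y)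
    ≡⟨ cong₂ (λ u v → expanded s u v (u * p + y * (c * c)) (u * q - y * c) (v * q + y)) sp≡ sq≡ ⟩
  expanded s d (x * c) (d * p + y * (c * c)) (d * q - y * c) (x * c * q + y)
    ≡⟨ cong₂ (λ u v → expanded u d (x * c) v (d * q - y * c) (x * c * q + y)) s≡ αα ⟩
  expanded (d + x * (c * c)) d (x * c) d (d * q - y * c) (x * c * q + y)
    ≡⟨ cong₂ (λ u v → expanded (d + x * (c * c)) d (x * c) d (u - y * c) v) αℓ ℓℓ ⟩
  expanded (d + x * (c * c)) d (x * c) d (y * c - y * c) x
    ≡⟨ solve 8 (λ d x c y h A L f →
         (d :+ x :* (c :* c)) :* (h :* h) :+ d :* (con 2ℚ :* h :* A) :+ (x :* c) :* (con 2ℚ :* h :* L)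
            :+ d :* (A :* A) :+ (y :* c :- y :* c) :* (con 2ℚ :* A :* L) :+ x :* (L :* L) :+ f
         := d :* ((h :+ A) :* (h :+ A)) :+ f :+ x :* ((c :* h :+ L) :* (c :* h :+ L)))
         refl d x c y h A L f ⟩
  d * sq (h + A) + f + x * sq (c * h + L) ∎
  where
  open ≡-Reasoning
  open Elimination (eliminate c 0≤d 0≤x)
  2ℚ = 1ℚ + 1ℚ
  A = α ∙ η
  L = ℓ ∙ η
  f = ⟦ F ⟧ η
  expanded : ℚ → ℚ → ℚ → ℚ → ℚ → ℚ → ℚ
  expanded hh hα hℓ αα αℓ ℓℓ =
    hh * (h * h) + hα * (2ℚ * h * A) + hℓ * (2ℚ * h * L) + αα * (A * A) + αℓ * (2ℚ * A * L) + ℓℓ * (L * L) + f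

-- The quadratic form of the adjugate matrix.
adj : Form r → Vec ℚ r → ℚ
adj []              []      = 0ℚ
adj (pivot d _ α F) (c ∷ ℓ) = c * c * det F + d * adj F (comb (- c) α 1ℚ ℓ)

-- The matrix determinant lemma. Only the product `s * y = x * d` enters, so no denominator remains
-- and singular forms are covered.
det-update : ∀ (F : Form r) x 0≤x ℓ → det (update F x 0≤x ℓ) ≡ det F + x * adj F ℓ
det-update []                x 0≤x []      = sym (trans (cong (1ℚ +_) (*-zeroʳ x)) (+-identityʳ 1ℚ))
det-update (pivot d 0≤d α F) x 0≤x (c ∷ ℓ) = begin
  s * det (update F y 0≤y ℓ′)             ≡⟨ cong (s *_) (det-update F y 0≤y ℓ′) ⟩
  s * (det F + y * adj F ℓ′)              ≡⟨ solve 4 (λ s D y E → s :* (D :+ y :* E) := s :* D :+ s :* y :* E) refl s (det F) y (adj F ℓ′) ⟩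
  s * det F + s * y * adj F ℓ′            ≡⟨ cong₂ (λ u v → u * det F + v * adj F ℓ′) s≡ sy≡ ⟩
  (d + x * (c * c)) * det F + x * d * adj F ℓ′
    ≡⟨ solve 5 (λ d x c D E → (d :+ x :* (c :* c)) :* D :+ x :* d :* E
                           := d :* D :+ x :* (c :* c :* D :+ d :* E)) refl d x c (det F) (adj F ℓ′) ⟩
  d * det F + x * (c * c * det F + d * adj F ℓ′) ∎
  where
  open ≡-Reasoning
  open Elimination (eliminate c 0≤d 0≤x)
  ℓ′ = comb (- c) α 1ℚ ℓ

-- The Laplacian form of a weighted graph

-- The last of the r + 1 vertices is grounded: its potential is 0.
_at_ : Vec ℚ r → Fin (suc r) → ℚ
[]      at _     = 0ℚ
(h ∷ η) at zero  = h
(h ∷ η) at suc a = η at a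

basis : Fin (suc r) → Vec ℚ r
basis {zero}  _       = []
basis {suc r} zero    = 1ℚ ∷ 0s
basis {suc r} (suc a) = 0ℚ ∷ basis a

basis-∙ : ∀ (a : Fin (suc r)) h → basis a ∙ h ≡ h at a
basis-∙ _       []      = refl
basis-∙ zero    (h ∷ η) = trans (cong₂ _+_ (*-identityˡ h) (0s-∙ η)) (+-identityʳ h)
basis-∙ (suc a) (h ∷ η) = trans (cong₂ _+_ (*-zeroˡ h) (basis-∙ a η)) (+-identityˡ (η at a))

-- The potential difference along the edge ab, up to sign.
edge : Fin (suc r) → Fin (suc r) → Vec ℚ r
edge {zero}  _       _       = []
edge {suc r} zero    zero    = 0s
edge {suc r} zero    (suc b) = - 1ℚ ∷ basis b
edge {suc r} (suc a) zero    = - 1ℚ ∷ basis a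
edge {suc r} (suc a) (suc b) = 0ℚ ∷ edge a b

edge-∙ : ∀ (a b : Fin (suc r)) h → sq (edge a b ∙ h) ≡ sq (h at a - h at b)
edge-∙ _       _       []      = refl
edge-∙ zero    zero    (h ∷ η) = cong sq (trans (0s-∙ (h ∷ η)) (sym (+-inverseʳ h)))
edge-∙ zero    (suc b) (h ∷ η) = trans (cong (λ u → sq (- 1ℚ * h + u)) (basis-∙ b η))
  (solve 2 (λ h k → (con (- 1ℚ) :* h :+ k) :* (con (- 1ℚ) :* h :+ k) := (h :- k) :* (h :- k)) refl h (η at b))
edge-∙ (suc a) zero    (h ∷ η) = trans (cong (λ u → sq (- 1ℚ * h + u)) (basis-∙ a η))
  (solve 2 (λ h k → (con (- 1ℚ) :* h :+ k) :* (con (- 1ℚ) :* h :+ k) := (k :- h) :* (k :- h)) refl h (η at a))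
edge-∙ (suc a) (suc b) (h ∷ η) = trans
  (cong sq (trans (cong (_+ edge a b ∙ η) (*-zeroˡ h)) (+-identityˡ (edge a b ∙ η))))
  (edge-∙ a b η)

-- Junk when a = b; so are pull, push and contract below.
merge : Fin (suc (suc r)) → Fin (suc (suc r)) → Fin (suc (suc r)) → Fin (suc r)
merge zero    zero    zero    = zero
merge zero    (suc b) zero    = b
merge (suc a) zero    zero    = a
merge (suc a) (suc b) zero    = zero
merge zero    b       (suc k) = k
merge (suc a) zero    (suc k) = k
merge {zero}  (suc a) (suc b) (suc k) = k
merge {suc r} (suc a) (suc b) (suc k) = suc (merge a b k)

pull : Fin (suc (suc r)) → Fin (suc (suc r)) → Vec ℚ r → Vec ℚ (suc r)
pull zero    zero    h = 0ℚ ∷ h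
pull zero    (suc b) h = h at b ∷ h
pull (suc a) zero    h = h at a ∷ h
pull (suc a) (suc b) []      = 0ℚ ∷ []
pull (suc a) (suc b) (h ∷ η) = h ∷ pull a b η

pull-at : ∀ {a b : Fin (suc (suc r))} → a ≢ b → ∀ h k → pull a b h at k ≡ h at merge a b k
pull-at {a = zero}  {zero}  a≢b h k       = contradiction refl a≢b
pull-at {a = zero}  {suc b} a≢b h zero    = refl
pull-at {a = zero}  {suc b} a≢b h (suc k) = refl
pull-at {a = suc a} {zero}  a≢b h zero    = refl
pull-at {a = suc a} {zero}  a≢b h (suc k) = refl
pull-at {a = suc zero} {suc zero} a≢b []  k = contradiction refl a≢b
pull-at {a = suc a} {suc b} a≢b (h ∷ η) zero    = refl
pull-at {a = suc a} {suc b} a≢b (h ∷ η) (suc k) = pull-at (a≢b ∘ cong suc) η k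

push : Fin (suc (suc r)) → Fin (suc (suc r)) → Vec ℚ (suc r) → Vec ℚ r
push zero    zero    (x ∷ α) = α
push zero    (suc b) (x ∷ α) = comb x (basis b) 1ℚ α
push (suc a) zero    (x ∷ α) = comb x (basis a) 1ℚ α
push {zero}  (suc a) (suc b) (x ∷ α) = []
push {suc r} (suc a) (suc b) (x ∷ α) = x ∷ push a b α

push-∙ : ∀ {a b : Fin (suc (suc r))} → a ≢ b → ∀ α h → push a b α ∙ h ≡ α ∙ pull a b h
push-∙ {a = zero}  {zero}  a≢b α h = contradiction refl a≢b
push-∙ {a = zero}  {suc b} a≢b (x ∷ α) h = trans (comb-∙ x (basis b) 1ℚ α h)
  (cong₂ (λ u v → x * u + v) (basis-∙ b h) (*-identityˡ (α ∙ h)))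
push-∙ {a = suc a} {zero}  a≢b (x ∷ α) h = trans (comb-∙ x (basis a) 1ℚ α h)
  (cong₂ (λ u v → x * u + v) (basis-∙ a h) (*-identityˡ (α ∙ h)))
push-∙ {zero}  {suc zero} {suc zero} a≢b α h = contradiction refl a≢b
push-∙ {suc r} {suc a} {suc b} a≢b (x ∷ α) (h ∷ η) = cong (x * h +_) (push-∙ (a≢b ∘ cong suc) α η)

-- Restriction of the form to potentials that agree at `a` and `b`. If the first vertex is one of
-- the two, its coordinate is replaced by the potential of the other, which turns the pivot square
-- into a rank-one update of `F`; otherwise the pivot survives and the restriction happens below it.
contract : Fin (suc (suc r)) → Fin (suc (suc r)) → Form (suc r) → Form r
contract zero    zero    (pivot d 0≤d α F) = F
contract zero    (suc b) (pivot d 0≤d α F) = update F d 0≤d (comb 1ℚ α 1ℚ (basis b))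
contract (suc a) zero    (pivot d 0≤d α F) = update F d 0≤d (comb 1ℚ α 1ℚ (basis a))
contract {zero}  (suc a) (suc b) (pivot d 0≤d α F) = F
contract {suc r} (suc a) (suc b) (pivot d 0≤d α F) = pivot d 0≤d (push a b α) (contract a b F)

private
  ⟦⟧-eliminated : ∀ d 0≤d α (F : Form r) b h →
    ⟦ update F d 0≤d (comb 1ℚ α 1ℚ (basis b)) ⟧ h ≡ ⟦ pivot d 0≤d α F ⟧ (h at b ∷ h)
  ⟦⟧-eliminated d 0≤d α F b h = begin
    ⟦ update F d 0≤d (comb 1ℚ α 1ℚ (basis b)) ⟧ h
      ≡⟨ ⟦⟧-update F d 0≤d _ h ⟩
    ⟦ F ⟧ h + d * sq (comb 1ℚ α 1ℚ (basis b) ∙ h)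
      ≡⟨ cong (λ u → ⟦ F ⟧ h + d * sq u) (comb-∙ 1ℚ α 1ℚ (basis b) h) ⟩
    ⟦ F ⟧ h + d * sq (1ℚ * (α ∙ h) + 1ℚ * (basis b ∙ h))
      ≡⟨ cong (λ u → ⟦ F ⟧ h + d * sq (1ℚ * (α ∙ h) + 1ℚ * u)) (basis-∙ b h) ⟩
    ⟦ F ⟧ h + d * sq (1ℚ * (α ∙ h) + 1ℚ * (h at b))
      ≡⟨ solve 4 (λ f d a h → f :+ d :* ((con 1ℚ :* a :+ con 1ℚ :* h) :* (con 1ℚ :* a :+ con 1ℚ :* h))
                           := d :* ((h :+ a) :* (h :+ a)) :+ f) refl (⟦ F ⟧ h) d (α ∙ h) (h at b) ⟩
    d * sq (h at b + α ∙ h) + ⟦ F ⟧ h ∎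
    where open ≡-Reasoning

⟦⟧-contract : ∀ {a b : Fin (suc (suc r))} → a ≢ b → ∀ F h → ⟦ contract a b F ⟧ h ≡ ⟦ F ⟧ (pull a b h)
⟦⟧-contract {a = zero}  {zero}  a≢b F h = contradiction refl a≢b
⟦⟧-contract {a = zero}  {suc b} a≢b (pivot d 0≤d α F) h = ⟦⟧-eliminated d 0≤d α F b h
⟦⟧-contract {a = suc a} {zero}  a≢b (pivot d 0≤d α F) h = ⟦⟧-eliminated d 0≤d α F a h
⟦⟧-contract {zero}  {suc zero} {suc zero} a≢b F h = contradiction refl a≢b
⟦⟧-contract {suc r} {suc a} {suc b} a≢b (pivot d 0≤d α F) (h ∷ η) = cong₂ (λ u v → d * sq (h + u) + v)
  (push-∙ (a≢b ∘ cong suc) α η) (⟦⟧-contract (a≢b ∘ cong suc) F η)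

private
  det-eliminated : ∀ d 0≤d α (F : Form r) b →
    det (update F d 0≤d (comb 1ℚ α 1ℚ (basis b))) ≡ adj (pivot d 0≤d α F) (- 1ℚ ∷ basis b)
  det-eliminated d 0≤d α F b = trans (det-update F d 0≤d _)
    (cong (_+ d * adj F (comb 1ℚ α 1ℚ (basis b))) (sym (*-identityˡ (det F))))

-- While neither endpoint is the first vertex, `edge a b` starts with 0 and both sides just gain the
-- factor `d`. Once one is, the entry is `- 1ℚ`, whose sign makes `- c` in `adj` the coefficient
-- `1ℚ` used by `contract`, and `det-update` applies.
det-contract : ∀ {a b : Fin (suc (suc r))} → a ≢ b → ∀ F → det (contract a b F) ≡ adj F (edge a b)
det-contract {a = zero}  {zero}  a≢b F = contradiction refl a≢b
det-contract {a = zero}  {suc b} a≢b (pivot d 0≤d α F) = det-eliminated d 0≤d α F b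
det-contract {a = suc a} {zero}  a≢b (pivot d 0≤d α F) = det-eliminated d 0≤d α F a
det-contract {zero}  {suc zero} {suc zero} a≢b F = contradiction refl a≢b
det-contract {suc r} {suc a} {suc b} a≢b (pivot d 0≤d α F) = begin
  d * det (contract a b F)  ≡⟨ cong (d *_) (det-contract (a≢b ∘ cong suc) F) ⟩
  d * adj F (edge a b)      ≡⟨ cong (λ ℓ → d * adj F ℓ) (comb-0-1 α (edge a b)) ⟨
  d * adj F ℓ               ≡⟨ solve 2 (λ D u → u := con 0ℚ :* con 0ℚ :* D :+ u) refl (det F) (d * adj F ℓ) ⟩
  0ℚ * 0ℚ * det F + d * adj F ℓ ∎
  where
  open ≡-Reasoning
  ℓ = comb (- 0ℚ) α 1ℚ (edge a b)

adj-loop : ∀ (F : Form r) → adj F 0s ≡ 0ℚ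
adj-loop []              = refl
adj-loop (pivot d _ α F) = trans
  (cong (λ u → 0ℚ * 0ℚ * det F + d * u) (trans (cong (adj F) (comb-0-1 α 0s)) (adj-loop F)))
  (solve 2 (λ D d → con 0ℚ :* con 0ℚ :* D :+ d :* con 0ℚ := con 0ℚ) refl (det F) d)

edge-loop : (a : Fin (suc r)) → edge a a ≡ 0s
edge-loop {zero}  _       = refl
edge-loop {suc r} zero    = refl
edge-loop {suc r} (suc a) = cong (0ℚ ∷_) (edge-loop a)

-- Laplacians and their contractions

zeroForm : ∀ r → Form r
zeroForm zero    = []
zeroForm (suc r) = pivot 0ℚ ≤-refl 0s (zeroForm r)

⟦⟧-zeroForm : (h : Vec ℚ r) → ⟦ zeroForm r ⟧ h ≡ 0ℚ
⟦⟧-zeroForm []      = refl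
⟦⟧-zeroForm (h ∷ η) = trans (cong₂ _+_ (*-zeroˡ (sq (h + 0s ∙ η))) (⟦⟧-zeroForm η)) (+-identityʳ 0ℚ)

laplacian : (Fin m → Fin (suc r) × Fin (suc r)) → (x : Fin m → ℚ) → (∀ e → 0ℚ ≤ x e) → Form r
laplacian {zero}  ends x 0≤x = zeroForm _
laplacian {suc m} ends x 0≤x = let a , b = ends zero in
  update (laplacian (ends ∘ suc) (x ∘ suc) (0≤x ∘ suc)) (x zero) (0≤x zero) (edge a b)

energy : (Fin m → Fin (suc r) × Fin (suc r)) → (Fin m → ℚ) → Vec ℚ r → ℚ
energy {zero}  ends x h = 0ℚ
energy {suc m} ends x h = let a , b = ends zero in
  energy (ends ∘ suc) (x ∘ suc) h + x zero * sq (h at a - h at b)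

⟦⟧-laplacian : ∀ (ends : Fin m → Fin (suc r) × Fin (suc r)) x 0≤x h →
  ⟦ laplacian ends x 0≤x ⟧ h ≡ energy ends x h
⟦⟧-laplacian {zero}  ends x 0≤x h = ⟦⟧-zeroForm h
⟦⟧-laplacian {suc m} ends x 0≤x h = let a , b = ends zero in trans
  (⟦⟧-update (laplacian (ends ∘ suc) (x ∘ suc) (0≤x ∘ suc)) (x zero) (0≤x zero) (edge a b) h)
  (cong₂ (λ u v → u + x zero * v) (⟦⟧-laplacian (ends ∘ suc) (x ∘ suc) (0≤x ∘ suc) h) (edge-∙ a b h))

mergeEnds : Fin (suc (suc r)) → Fin (suc (suc r)) →
  (Fin m → Fin (suc (suc r)) × Fin (suc (suc r))) → Fin m → Fin (suc r) × Fin (suc r)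
mergeEnds a b ends e = let u , v = ends e in merge a b u , merge a b v

energy-pull : ∀ {a b : Fin (suc (suc r))} → a ≢ b → ∀ (ends : Fin m → _) x h →
  energy ends x (pull a b h) ≡ energy (mergeEnds a b ends) x h
energy-pull {m = zero}  a≢b ends x h = refl
energy-pull {m = suc m} a≢b ends x h = cong₂ _+_ (energy-pull a≢b (ends ∘ suc) (x ∘ suc) h)
  (cong₂ (λ u v → x zero * sq (u - v)) (pull-at a≢b h _) (pull-at a≢b h _))

-- The contracted Laplacian and the Laplacian of the merged graph are in general different
-- factorisations, but they take the same values, so `det-unique` identifies their determinants.
adj-laplacian : ∀ {a b : Fin (suc (suc r))} → a ≢ b → ∀ (ends : Fin m → _) x 0≤x →
  adj (laplacian ends x 0≤x) (edge a b) ≡ det (laplacian (mergeEnds a b ends) x 0≤x)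
adj-laplacian {a = a} {b} a≢b ends x 0≤x = trans (sym (det-contract a≢b (laplacian ends x 0≤x)))
  (det-unique (contract a b (laplacian ends x 0≤x)) (laplacian (mergeEnds a b ends) x 0≤x) λ h → begin
    ⟦ contract a b (laplacian ends x 0≤x) ⟧ h  ≡⟨ ⟦⟧-contract a≢b (laplacian ends x 0≤x) h ⟩
    ⟦ laplacian ends x 0≤x ⟧ (pull a b h)      ≡⟨ ⟦⟧-laplacian ends x 0≤x (pull a b h) ⟩
    energy ends x (pull a b h)                 ≡⟨ energy-pull a≢b ends x h ⟩
    energy (mergeEnds a b ends) x h            ≡⟨ ⟦⟧-laplacian (mergeEnds a b ends) x 0≤x h ⟨
    ⟦ laplacian (mergeEnds a b ends) x 0≤x ⟧ h ∎)
  where open ≡-Reasoning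

midpoint : (Fin m → ℚ) → (Fin m → ℚ) → Fin m → ℚ
midpoint x y j = ½ * (x j + y j)

energy-midpoint : ∀ (ends : Fin m → Fin (suc r) × Fin (suc r)) x y h →
  energy ends x h + energy ends y h ≡
  energy ends (midpoint x y) h + energy ends (midpoint x y) h
energy-midpoint {zero}  ends x y h = refl
energy-midpoint {suc m} ends x y h = begin
  p + x zero * s + (q + y zero * s)
    ≡⟨ solve 5 (λ p q a b s → p :+ a :* s :+ (q :+ b :* s) := p :+ q :+ (a :+ b) :* s) refl
         p q (x zero) (y zero) s ⟩
  p + q + (x zero + y zero) * s
    ≡⟨ cong (_+ (x zero + y zero) * s) (energy-midpoint (ends ∘ suc) (x ∘ suc) (y ∘ suc) h) ⟩
  w + w + (x zero + y zero) * s
    ≡⟨ solve 4 (λ w a b s → w :+ w :+ (a :+ b) :* s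
         := w :+ con ½ :* (a :+ b) :* s :+ (w :+ con ½ :* (a :+ b) :* s)) refl
         w (x zero) (y zero) s ⟩
  w + ½ * (x zero + y zero) * s + (w + ½ * (x zero + y zero) * s) ∎
  where
  open ≡-Reasoning
  p = energy (ends ∘ suc) (x ∘ suc) h
  q = energy (ends ∘ suc) (y ∘ suc) h
  w = energy (ends ∘ suc) (midpoint (x ∘ suc) (y ∘ suc)) h
  s = sq (h at proj₁ (ends zero) - h at proj₂ (ends zero))

laplacian-log-concave : ∀ (ends : Fin m → Fin (suc r) × Fin (suc r)) x y 0≤x 0≤y 0≤w →
  let L = laplacian ends (midpoint x y) 0≤w in
  det (laplacian ends x 0≤x) * det (laplacian ends y 0≤y) ≤ det L * det L
laplacian-log-concave ends x y 0≤x 0≤y 0≤w =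
  det-log-concave (laplacian ends x 0≤x) (laplacian ends y 0≤y) (laplacian ends _ 0≤w) λ h → ≤-reflexive
    (trans (cong₂ _+_ (⟦⟧-laplacian ends x 0≤x h) (⟦⟧-laplacian ends y 0≤y h))
    (trans (energy-midpoint ends x y h)
    (sym (cong₂ _+_ (⟦⟧-laplacian ends _ 0≤w h) (⟦⟧-laplacian ends _ 0≤w h)))))

-- Spanning trees under deletion and contraction

Ends : ℕ → ℕ → Set
Ends m n = Fin m → Fin n × Fin n

Conn : Ends m n → Subset m → Set
Conn ends T = ∀ u v → Star (Adj ends T) u v

-- The edge count stands in for acyclicity: it passes through deletion and contraction at once,
-- whereas `IsCycle` demands length at least 3 and would miss the loops and double edges that
-- contraction creates.
Tree : Ends m n → Subset m → Set
Tree {n = n} ends T = Conn ends T × n ≡ suc Subset.∣ T ∣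

merge-identifies : ∀ {a b : Fin (suc (suc r))} → a ≢ b → merge a b a ≡ merge a b b
merge-identifies {a = zero}  {zero}  a≢b = refl
merge-identifies {a = zero}  {suc b} a≢b = refl
merge-identifies {a = suc a} {zero}  a≢b = refl
merge-identifies {zero}  {suc zero} {suc zero} a≢b = refl
merge-identifies {suc r} {suc a} {suc b} a≢b = cong suc (merge-identifies (a≢b ∘ cong suc))

merge-fibre : ∀ {a b : Fin (suc (suc r))} → a ≢ b → ∀ u v → merge a b u ≡ merge a b v →
  u ≡ v ⊎ (u ≡ a × v ≡ b) ⊎ (u ≡ b × v ≡ a)
merge-fibre {a = zero}  {zero}  a≢b u v _ = contradiction refl a≢b
merge-fibre {a = zero}  {suc b} a≢b zero    zero    eq = inj₁ refl
merge-fibre {a = zero}  {suc b} a≢b zero    (suc v) eq = inj₂ (inj₁ (refl , cong suc (sym eq)))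
merge-fibre {a = zero}  {suc b} a≢b (suc u) zero    eq = inj₂ (inj₂ (cong suc eq , refl))
merge-fibre {a = zero}  {suc b} a≢b (suc u) (suc v) eq = inj₁ (cong suc eq)
merge-fibre {a = suc a} {zero}  a≢b zero    zero    eq = inj₁ refl
merge-fibre {a = suc a} {zero}  a≢b zero    (suc v) eq = inj₂ (inj₂ (refl , cong suc (sym eq)))
merge-fibre {a = suc a} {zero}  a≢b (suc u) zero    eq = inj₂ (inj₁ (cong suc eq , refl))
merge-fibre {a = suc a} {zero}  a≢b (suc u) (suc v) eq = inj₁ (cong suc eq)
merge-fibre {zero}  {suc zero} {suc zero} a≢b u v _ = contradiction refl a≢b
merge-fibre {suc r} {suc a} {suc b} a≢b zero    zero    eq = inj₁ refl
merge-fibre {suc r} {suc a} {suc b} a≢b (suc u) (suc v) eq = Sum.map (cong suc)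
  (Sum.map (Product.map (cong suc) (cong suc)) (Product.map (cong suc) (cong suc)))
  (merge-fibre (a≢b ∘ cong suc) u v (Fin.suc-injective eq))

merge-surjective : ∀ {a b : Fin (suc (suc r))} → a ≢ b → ∀ p → ∃ λ u → merge a b u ≡ p
merge-surjective {a = zero}  {zero}  a≢b p = contradiction refl a≢b
merge-surjective {a = zero}  {suc b} a≢b p = suc p , refl
merge-surjective {a = suc a} {zero}  a≢b p = suc p , refl
merge-surjective {zero}  {suc zero} {suc zero} a≢b p = contradiction refl a≢b
merge-surjective {suc r} {suc a} {suc b} a≢b zero    = zero , refl
merge-surjective {suc r} {suc a} {suc b} a≢b (suc p) =
  Product.map suc (cong suc) (merge-surjective (a≢b ∘ cong suc) p)

≡⇒Star : ∀ {A : Set} {R : Rel A 0ℓ} {u v} → u ≡ v → Star R u v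
≡⇒Star refl = Star.ε

Adj-sym : ∀ {ends : Ends m n} {T u v} → Adj ends T u v → Adj ends T v u
Adj-sym (e , e∈T , eq) = e , e∈T , Sum.swap eq

strengthen : ∀ {ends : Ends (suc m) n} {T u v} →
  Star (Adj ends (outside ∷ T)) u v → Star (Adj (ends ∘ suc) T) u v
strengthen = Star.map λ { (suc e , there e∈T , eq) → e , e∈T , eq }

remove-loop : ∀ (ends : Ends (suc m) n) {T} → proj₁ (ends zero) ≡ proj₂ (ends zero) →
  ∀ {u v} → Star (Adj ends (inside ∷ T)) u v → Star (Adj (ends ∘ suc) T) u v
remove-loop ends {T} a≡b p with split ends T p
... | inj₁ q              = q
... | inj₂ (inj₁ (q , s)) = q ◅◅ ≡⇒Star a≡b ◅◅ s
... | inj₂ (inj₂ (q , s)) = q ◅◅ ≡⇒Star (sym a≡b) ◅◅ s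

module Contraction (ends : Ends (suc m) (suc (suc r)))
                   (a≢b : proj₁ (ends zero) ≢ proj₂ (ends zero)) where

  a = proj₁ (ends zero)
  b = proj₂ (ends zero)

  merged : Ends m (suc r)
  merged = mergeEnds a b (ends ∘ suc)

  merge-path : ∀ {T u v} → Star (Adj ends (inside ∷ T)) u v →
    Star (Adj merged T) (merge a b u) (merge a b v)
  merge-path = Star.kleisliStar (merge a b) λ
    { (suc e , there e∈T , eq) →
        (e , e∈T , Sum.map (cong (Product.map (merge a b) (merge a b)))
                           (cong (Product.map (merge a b) (merge a b))) eq) ◅ Star.ε
    ; (zero , here , inj₁ refl) → ≡⇒Star (merge-identifies a≢b)
    ; (zero , here , inj₂ refl) → ≡⇒Star (sym (merge-identifies a≢b)) }

  fibre-path : ∀ {T u v} → merge a b u ≡ merge a b v → Star (Adj ends (inside ∷ T)) u v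
  fibre-path {u = u} {v} eq with merge-fibre a≢b u v eq
  ... | inj₁ refl                 = Star.ε
  ... | inj₂ (inj₁ (refl , refl)) = (zero , here , inj₁ refl) ◅ Star.ε
  ... | inj₂ (inj₂ (refl , refl)) = (zero , here , inj₂ refl) ◅ Star.ε

  -- Each merged edge lifts to an original edge whose ends have the right images; consecutive lifts
  -- may end and start at different vertices of one fibre, and `fibre-path` bridges them by edge
  -- `zero`.
  unmerge-path : ∀ {T p q} → Star (Adj merged T) p q → ∀ {u v} → merge a b u ≡ p → merge a b v ≡ q →
    Star (Adj ends (inside ∷ T)) u v
  unmerge-path Star.ε                              u≡ v≡ = fibre-path (trans u≡ (sym v≡))
  unmerge-path ((e , e∈T , inj₁ eq) ◅ path) u≡ v≡ =
    fibre-path (trans u≡ (sym (cong proj₁ eq)))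
      ◅◅ (suc e , there e∈T , inj₁ refl) ◅ unmerge-path path (cong proj₂ eq) v≡
  unmerge-path ((e , e∈T , inj₂ eq) ◅ path) u≡ v≡ =
    fibre-path (trans u≡ (sym (cong proj₂ eq)))
      ◅◅ (suc e , there e∈T , inj₂ refl) ◅ unmerge-path path (cong proj₁ eq) v≡

  merge-conn : ∀ {T} → Conn ends (inside ∷ T) → Conn merged T
  merge-conn conn p q with merge-surjective a≢b p | merge-surjective a≢b q
  ... | u , refl | v , refl = merge-path (conn u v)

  unmerge-conn : ∀ {T} → Conn merged T → Conn ends (inside ∷ T)
  unmerge-conn conn u v = unmerge-path (conn _ _) refl refl

Fin1-unique : (a b : Fin 1) → a ≡ b
Fin1-unique zero zero = refl

conn⇒≤ : (ends : Ends m n) (T : Subset m) → Conn ends T → n ℕ.≤ suc Subset.∣ T ∣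
conn⇒≤ {n = zero}        ends T             conn = z≤n
conn⇒≤ {n = suc zero}    ends T             conn = s≤s z≤n
conn⇒≤ {n = suc (suc r)} ends []            conn with conn zero (suc zero)
... | () ◅ _
conn⇒≤ {n = suc (suc r)} ends (outside ∷ T) conn = conn⇒≤ (ends ∘ suc) T λ u v → strengthen (conn u v)
conn⇒≤ {n = suc (suc r)} ends (inside ∷ T)  conn with proj₁ (ends zero) Fin.≟ proj₂ (ends zero)
... | yes a≡b = ℕ.m≤n⇒m≤1+n (conn⇒≤ (ends ∘ suc) T λ u v → remove-loop ends a≡b (conn u v))
... | no  a≢b = s≤s (conn⇒≤ merged T (merge-conn conn))
  where open Contraction ends a≢b

Tree-outside : ∀ (ends : Ends (suc m) n) T → Tree ends (outside ∷ T) ⇔ Tree (ends ∘ suc) T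
Tree-outside ends T = mk⇔
  (Product.map₁ λ conn u v → strengthen (conn u v))
  (Product.map₁ λ conn u v → weaken (conn u v))

-- Dropping the loop would keep the graph connected with one edge too few for `conn⇒≤`.
Tree-loop : ∀ (ends : Ends (suc m) n) T → proj₁ (ends zero) ≡ proj₂ (ends zero) →
  ¬ Tree ends (inside ∷ T)
Tree-loop ends T a≡b (conn , n≡) = ℕ.<-irrefl n≡
  (s≤s (conn⇒≤ (ends ∘ suc) T λ u v → remove-loop ends a≡b (conn u v)))

Tree-merge : ∀ (ends : Ends (suc m) (suc (suc r))) T (a≢b : proj₁ (ends zero) ≢ proj₂ (ends zero)) →
  Tree ends (inside ∷ T) ⇔ Tree (mergeEnds (proj₁ (ends zero)) (proj₂ (ends zero)) (ends ∘ suc)) T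
Tree-merge ends T a≢b = mk⇔
  (Product.map merge-conn ℕ.suc-injective) (Product.map unmerge-conn (cong suc))
  where open Contraction ends a≢b

-- Acyclicity versus edge count

-- Every chosen edge is a bridge. This mediates between `Acyclic` and `Tree`: it speaks of paths
-- only, so it is inherited by contractions, loops included.
Minimal : Ends m n → Subset m → Set
Minimal ends T = ∀ e → e ∈ T → ¬ Star (Adj ends (T Subset.- e)) (proj₁ (ends e)) (proj₂ (ends e))

-- A bridge is no loop, so the first chosen edge can be contracted. A detour around `e` in the
-- merged graph would lift to one in the original, hence minimality persists, and each contraction
-- accounts for one vertex and one edge.
minimal⇒Tree : ∀ (ends : Ends m (suc r)) T → Conn ends T → Minimal ends T → Tree ends T
minimal⇒Tree ends T conn min = conn , cong suc (edges ends T conn min)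
  where
  edges : ∀ {m r} (ends : Ends m (suc r)) T → Conn ends T → Minimal ends T → r ≡ Subset.∣ T ∣
  edges {zero}  {zero}  ends []            conn min = refl
  edges {zero}  {suc r} ends []            conn min with conn zero (suc zero)
  ... | () ◅ _
  edges {suc m} ends (outside ∷ T) conn min =
    edges (ends ∘ suc) T (λ u v → strengthen (conn u v))
      λ e e∈T p → min (suc e) (there e∈T) (weaken p)
  edges {suc m} {zero}  ends (inside ∷ T)  conn min =
    contradiction (≡⇒Star (Fin1-unique _ _)) (min zero here)
  edges {suc m} {suc r} ends (inside ∷ T)  conn min = cong suc
    (edges merged T (merge-conn conn)
      λ e e∈T p → min (suc e) (there e∈T) (unmerge-path p refl refl))
    where open Contraction ends (min zero here ∘ ≡⇒Star)

module _ {n : ℕ} {R : Rel (Fin n) 0ℓ} where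

  len : ∀ {u v} → Star R u v → ℕ
  len Star.ε       = 0
  len (_ ◅ p) = suc (len p)

  later : ∀ {u v} (p : Star R u v) → Vec (Fin n) (len p)
  later Star.ε                 = []
  later (_◅_ {j = w} _ p) = w ∷ later p

  Simple : Fin n → Fin n → Set
  Simple u v = Σ (Star R u v) λ p → Unique (u ∷ later p)

  shortcut : ∀ x {w v} (p : Star R w v) → Unique (w ∷ later p) →
    All (x ≢_) (w ∷ later p) ⊎ Simple x v
  shortcut x {w} p u with x Fin.≟ w
  ... | yes refl = inj₂ (p , u)
  shortcut x Star.ε u | no x≢w = inj₁ (x≢w ∷ [])
  shortcut x (_ ◅ p) (_ ∷ u) | no x≢w = Sum.map₁ (x≢w ∷_) (shortcut x p u)

  -- Loop erasure: if the new first vertex already lies on the simplified rest, the path restarts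
  -- from that visit.
  simplify : ∀ {u v} → Star R u v → Simple u v
  simplify Star.ε = Star.ε , [] ∷ []
  simplify {u} (s ◅ p) with simplify p
  ... | q , uq with shortcut u q uq
  ...   | inj₁ fresh = s ◅ q , fresh ∷ uq
  ...   | inj₂ q′    = q′

  close : ∀ {S : Rel (Fin n) 0ℓ} → (∀ {u v} → R u v → S u v) → ∀ {u v w} (p : Star R u v) → S v w →
    Linked S (u ∷ (later p Vec.∷ʳ w))
  close R⇒S Star.ε       s = s ∷ [-]
  close R⇒S (_◅_ {j = w} s′ p) s = R⇒S s′ ∷ close R⇒S p s

x∉p-x : ∀ (p : Subset n) x → ¬ (x ∈ p Subset.- x)
x∉p-x (true  ∷ p) zero ()
x∉p-x (false ∷ p) zero ()
x∉p-x (s ∷ p) (suc x) (there x∈) = x∉p-x p x x∈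

module _ (G : Graph) where
  open Graph G

  private
    endpoints≢ : ∀ e {u v} → ends e ≡ (u , v) → u ≢ v
    endpoints≢ e refl = Fin.<⇒≢ (ordered e)

    endpoints-asym : ∀ e f {u v} → ends e ≡ (u , v) → ends f ≢ (v , u)
    endpoints-asym e f refl eq = Fin.<-asym (ordered e)
      (subst₂ Fin._<_ (cong proj₁ eq) (cong proj₂ eq) (ordered f))

  -- A path joining the ends of e in T - e closes up to a cycle; simplicity
  -- of G rules out cycles of length 1 and 2.
  acyclic⇒minimal : ∀ T → Acyclic G T → Minimal ends T
  acyclic⇒minimal T acyclic e e∈T p = cyclic refl (simplify p)
    where
    cyclic : ∀ {u v} → ends e ≡ (u , v) → ¬ Simple {R = Adj ends (T Subset.- e)} u v
    cyclic e≡ (Star.ε , _) = endpoints≢ e e≡ refl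
    cyclic e≡ ((f , f∈ , inj₁ f≡) ◅ Star.ε , _) =
      x∉p-x T e (subst (_∈ T Subset.- e) (injective (trans f≡ (sym e≡))) f∈)
    cyclic e≡ ((f , f∈ , inj₂ f≡) ◅ Star.ε , _) = endpoints-asym e f e≡ f≡
    cyclic e≡ (q@(_ ◅ _ ◅ _) , unique) = acyclic _ (_ ∷ later q)
      ( s≤s (s≤s (s≤s z≤n)) , unique
      , close (λ (f , f∈ , eq) → f , Subset.p─q⊆p T _ f∈ , eq) q (e , e∈T , inj₂ e≡))

  private
    Incident : Fin #E → Fin #V → Set
    Incident e u = proj₁ (ends e) ≡ u ⊎ proj₂ (ends e) ≡ u

    avoid : ∀ {T e u v w} (uv : Adj ends T u v) → Incident (proj₁ uv) w → ¬ Incident e w →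
      Adj ends (T Subset.- e) u v
    avoid (f , f∈T , eq) f∋w e∌w =
      f , Subset.x∈p∧x≢y⇒x∈p-y f∈T (λ { refl → e∌w f∋w }) , eq

    source : ∀ {T u v} (uv : Adj ends T u v) → Incident (proj₁ uv) u
    source (f , _ , eq) = Sum.map (cong proj₁) (cong proj₂) eq

    walk : ∀ {T e v k} x (xs : Vec (Fin #V) k) →
      All (λ w → ¬ Incident e w) (x ∷ xs) → Linked (Adj ends T) (x ∷ (xs Vec.∷ʳ v)) →
      Star (Adj ends (T Subset.- e)) x v
    walk x []       (e∌x ∷ _)   (xv ∷ _)      = avoid xv (source xv) e∌x ◅ Star.ε
    walk x (y ∷ ys) (e∌x ∷ e∌s) (xy ∷ linked) = avoid xy (source xy) e∌x ◅ walk y ys e∌s linked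

    not-incident : ∀ {T v w x} (vw : Adj ends T v w) → v ≢ x → w ≢ x → ¬ Incident (proj₁ vw) x
    not-incident (_ , _ , inj₁ refl) v≢x w≢x = [ v≢x , w≢x ]′
    not-incident (_ , _ , inj₂ refl) v≢x w≢x = [ w≢x , v≢x ]′

    not-incident-all : ∀ {T v w k} (vw : Adj ends T v w) {xs : Vec (Fin #V) k} →
      All (v ≢_) xs → All (w ≢_) xs → All (λ x → ¬ Incident (proj₁ vw) x) xs
    not-incident-all vw []           []           = []
    not-incident-all vw (v≢x ∷ v≢xs) (w≢x ∷ w≢xs) =
      not-incident vw v≢x w≢x ∷ not-incident-all vw v≢xs w≢xs

  -- The redundant edge is the first one, `vw`. The rest of the cycle leads from `w` back to `v`,
  -- and each of its steps touches some vertex other than `v` and `w`, so none of them uses `vw`.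
  cycle⇒redundant : ∀ {T k} (vs : Vec (Fin #V) (suc k)) → IsCycle G T vs →
    ∃ λ e → e ∈ T × Star (Adj ends (T Subset.- e)) (proj₁ (ends e)) (proj₂ (ends e))
  cycle⇒redundant (v ∷ []) (s≤s () , _)
  cycle⇒redundant (v ∷ w ∷ []) (s≤s (s≤s ()) , _)
  cycle⇒redundant (v ∷ w ∷ x ∷ ys)
    (_ , (v≢w ∷ v≢x ∷ v≢ys) ∷ (w≢x ∷ w≢ys) ∷ _ , vw@(e , e∈T , e≡) ∷ wx ∷ linked) =
    -- The step from `w` to `x` is reversed because its vertex off `e` is the target, while `source`
    -- certifies the start of a step.
    e , e∈T , orient {e} e≡ (Adj-sym (avoid (Adj-sym wx) (source (Adj-sym wx)) (not-incident vw v≢x w≢x))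
      ◅ walk x ys (not-incident-all vw (v≢x ∷ v≢ys) (w≢x ∷ w≢ys)) linked)
    where
    orient : ∀ {e v w T} → ends e ≡ (v , w) ⊎ ends e ≡ (w , v) →
      Star (Adj ends T) w v → Star (Adj ends T) (proj₁ (ends e)) (proj₂ (ends e))
    orient (inj₁ refl) p = Star.reverse Adj-sym p
    orient (inj₂ refl) p = p

redundant-conn : ∀ {ends : Ends m n} {T e} → Conn ends T →
  Star (Adj ends (T Subset.- e)) (proj₁ (ends e)) (proj₂ (ends e)) → Conn ends (T Subset.- e)
redundant-conn {ends = ends} {T} {e} conn p u v = conn u v Star.>>= λ
    (f , f∈T , eq) → detour f f∈T eq (f Fin.≟ e)
  where
  detour : ∀ f → f ∈ T → ∀ {u v} → ends f ≡ (u , v) ⊎ ends f ≡ (v , u) → Dec (f ≡ e) →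
    Star (Adj ends (T Subset.- e)) u v
  detour f f∈T eq          (no f≢e)   = (f , Subset.x∈p∧x≢y⇒x∈p-y f∈T f≢e , eq) ◅ Star.ε
  detour f f∈T (inj₁ refl) (yes refl) = p
  detour f f∈T (inj₂ refl) (yes refl) = Star.reverse Adj-sym p

-- If an edge of `T` had a detour, removing it would leave a connected set with too few edges.
Tree⇒minimal : ∀ (ends : Ends m n) T → Tree ends T → Minimal ends T
Tree⇒minimal ends T (conn , n≡) e e∈T p = ℕ.<⇒≱ (s≤s (Subset.x∈p⇒∣p-x∣<∣p∣ e∈T))
  (subst (ℕ._≤ suc Subset.∣ T Subset.- e ∣) n≡ (conn⇒≤ ends (T Subset.- e) (redundant-conn conn p)))

spanningTree⇔Tree : ∀ G T → IsSpanningTree G T ⇔ Tree (Graph.ends G) T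
spanningTree⇔Tree G T = mk⇔
  (λ ((0<#V , conn) , acyclic) → nonempty 0<#V ends conn (acyclic⇒minimal G T acyclic))
  (λ tree@(conn , #V≡) → (subst (0 ℕ.<_) (sym #V≡) (s≤s z≤n) , conn) ,
    λ k vs cycle → let e , e∈T , p = cycle⇒redundant G vs cycle in Tree⇒minimal ends T tree e e∈T p)
  where
  open Graph G
  nonempty : ∀ {n} → 0 ℕ.< n → (ends : Ends #E n) → Conn ends T → Minimal ends T → Tree ends T
  nonempty (s≤s _) ends = minimal⇒Tree ends T

-- The matrix-tree theorem

weight : Subset m → (Fin m → ℚ) → ℚ
weight []      x = 1ℚ
weight (s ∷ T) x = (if s then x zero else 1ℚ) * weight T (x ∘ suc)

∑weight : List (Subset m) → (Fin m → ℚ) → ℚ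
∑weight L x = List.foldr (λ T s → weight T x + s) 0ℚ L

∑weight-++ : ∀ (K L : List (Subset m)) x → ∑weight (K ++ L) x ≡ ∑weight K x + ∑weight L x
∑weight-++ List.[]      L x = sym (+-identityˡ (∑weight L x))
∑weight-++ (T List.∷ K) L x = trans (cong (weight T x +_) (∑weight-++ K L x))
  (sym (+-assoc (weight T x) (∑weight K x) (∑weight L x)))

∑weight-map : ∀ s (L : List (Subset m)) x →
  ∑weight (List.map (s ∷_) L) x ≡ (if s then x zero else 1ℚ) * ∑weight L (x ∘ suc)
∑weight-map s List.[]      x = sym (*-zeroʳ (if s then x zero else 1ℚ))
∑weight-map s (T List.∷ L) x = trans (cong (weight (s ∷ T) x +_) (∑weight-map s L x))
  (sym (*-distribˡ-+ (if s then x zero else 1ℚ) (weight T (x ∘ suc)) (∑weight L (x ∘ suc))))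

filter-map : ∀ {A B : Set} {P : Pred B 0ℓ} (P? : Decidable P) (f : A → B) xs →
  filter P? (List.map f xs) ≡ List.map f (filter (P? ∘ f) xs)
filter-map P? f List.[] = refl
filter-map P? f (x List.∷ xs) with P? (f x)
... | yes _ = cong (f x List.∷_) (filter-map P? f xs)
... | no  _ = filter-map P? f xs

-- Deletion and contraction of the first edge match the two terms of `det-update`. The predicate is
-- any decidable equivalent of `Tree`, so that the induction can continue with `P? ∘ (outside ∷_)`
-- and `P? ∘ (inside ∷_)`.
matrix-tree : ∀ (ends : Ends m (suc r)) {P : Pred (Subset m) 0ℓ} (P? : Decidable P) →
  (∀ T → P T ⇔ Tree ends T) → ∀ x 0≤x →
  ∑weight (filter P? (subsets m)) x ≡ det (laplacian ends x 0≤x)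
matrix-tree {zero} {zero} ends P? P⇔ x 0≤x with P? []
... | yes _ = refl
... | no ¬p = contradiction (Equivalence.from (P⇔ []) ((λ u v → ≡⇒Star (Fin1-unique u v)) , refl)) ¬p
matrix-tree {zero} {suc r} ends P? P⇔ x 0≤x with P? []
... | yes p = contradiction (proj₂ (Equivalence.to (P⇔ []) p)) λ ()
... | no _  = sym (*-zeroˡ (det (zeroForm r)))
matrix-tree {suc m} {r} ends {P} P? P⇔ x 0≤x = begin
  ∑weight (filter P? (List.map (outside ∷_) (subsets m) ++ List.map (inside ∷_) (subsets m))) x
    ≡⟨ cong (λ L → ∑weight L x) (trans
         (List.filter-++ P? (List.map (outside ∷_) (subsets m)) (List.map (inside ∷_) (subsets m)))
         (cong₂ _++_ (filter-map P? (outside ∷_) (subsets m)) (filter-map P? (inside ∷_) (subsets m)))) ⟩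
  ∑weight (List.map (outside ∷_) outs ++ List.map (inside ∷_) ins) x
    ≡⟨ ∑weight-++ (List.map (outside ∷_) outs) (List.map (inside ∷_) ins) x ⟩
  ∑weight (List.map (outside ∷_) outs) x + ∑weight (List.map (inside ∷_) ins) x
    ≡⟨ cong₂ _+_ (∑weight-map outside outs x) (∑weight-map inside ins x) ⟩
  1ℚ * ∑weight outs (x ∘ suc) + x zero * ∑weight ins (x ∘ suc)
    ≡⟨ cong₂ (λ u v → u + x zero * v) (trans (*-identityˡ _) deletion) (contraction ends P⇔ (a Fin.≟ b)) ⟩
  det F + x zero * adj F (edge a b)
    ≡⟨ det-update F (x zero) (0≤x zero) (edge a b) ⟨
  det (laplacian ends x 0≤x) ∎
  where
  open ≡-Reasoning
  a = proj₁ (ends zero)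
  b = proj₂ (ends zero)
  F = laplacian (ends ∘ suc) (x ∘ suc) (0≤x ∘ suc)
  outs = filter (P? ∘ (outside ∷_)) (subsets m)
  ins  = filter (P? ∘ (inside ∷_)) (subsets m)

  deletion : ∑weight outs (x ∘ suc) ≡ det F
  deletion = matrix-tree (ends ∘ suc) (P? ∘ (outside ∷_))
    (λ T → ⇔.trans (P⇔ (outside ∷ T)) (Tree-outside ends T)) (x ∘ suc) (0≤x ∘ suc)

  -- Generalised over `r` to allow a case split: an edge that is no loop needs a second vertex,
  -- which `merge` requires.
  contraction : ∀ {r} (ends : Ends (suc m) (suc r)) → (∀ T → P T ⇔ Tree ends T) →
    let a , b = ends zero in Dec (a ≡ b) →
    ∑weight ins (x ∘ suc) ≡ adj (laplacian (ends ∘ suc) (x ∘ suc) (0≤x ∘ suc)) (edge a b)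
  contraction ends P⇔ (yes a≡b) = begin
    ∑weight ins (x ∘ suc)
      ≡⟨ cong (λ L → ∑weight L (x ∘ suc)) (List.filter-none (P? ∘ (inside ∷_)) (ListAll.universal
           (λ T → Tree-loop ends T a≡b ∘ Equivalence.to (P⇔ (inside ∷ T))) (subsets m))) ⟩
    0ℚ
      ≡⟨ adj-loop F′ ⟨
    adj F′ 0s
      ≡⟨ cong (adj F′) (trans (cong (edge (proj₁ (ends zero))) (sym a≡b)) (edge-loop _)) ⟨
    adj F′ (edge (proj₁ (ends zero)) (proj₂ (ends zero))) ∎
    where F′ = laplacian (ends ∘ suc) (x ∘ suc) (0≤x ∘ suc)
  contraction {zero}  ends P⇔ (no a≢b) = contradiction (Fin1-unique _ _) a≢b
  contraction {suc r} ends P⇔ (no a≢b) = trans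
    (matrix-tree merged (P? ∘ (inside ∷_))
      (λ T → ⇔.trans (P⇔ (inside ∷ T)) (Tree-merge ends T a≢b)) (x ∘ suc) (0≤x ∘ suc))
    (sym (adj-laplacian a≢b (ends ∘ suc) (x ∘ suc) (0≤x ∘ suc)))
    where open Contraction ends a≢b

-- Log-concavity

∑weight-none : ∀ {P : Pred (Subset m) 0ℓ} (P? : Decidable P) → (∀ T → ¬ P T) → ∀ x →
  ∑weight (filter P? (subsets m)) x ≡ 0ℚ
∑weight-none P? ¬P x = cong (λ L → ∑weight L x) (List.filter-none P? (ListAll.universal ¬P (subsets _)))

NonNeg : (Fin m → ℚ) → Set
NonNeg x = ∀ j → 0ℚ ≤ x j

midpoint-nonneg : ∀ {x y : Fin m → ℚ} → NonNeg x → NonNeg y → NonNeg (midpoint x y)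
midpoint-nonneg 0≤x 0≤y j = *-nonneg (nonNegative⁻¹ ½) (+-nonneg (0≤x j) (0≤y j))

LogConcave : ((Fin m → ℚ) → ℚ) → Set
LogConcave f = ∀ x y → NonNeg x → NonNeg y → f x * f y ≤ sq (f (midpoint x y))

trees-log-concave : ∀ (ends : Ends m n) {P : Pred (Subset m) 0ℓ} (P? : Decidable P) →
  (∀ T → P T ⇔ Tree ends T) → LogConcave (∑weight (filter P? (subsets m)))
trees-log-concave {n = zero} ends P? P⇔ x y 0≤x 0≤y =
  ≤-reflexive (trans (cong₂ _*_ (none x) (none y)) (sym (cong sq (none (midpoint x y)))))
  where none = ∑weight-none P? λ T p → contradiction (proj₂ (Equivalence.to (P⇔ T) p)) λ ()
trees-log-concave {n = suc r} ends P? P⇔ x y 0≤x 0≤y = subst₂ _≤_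
  (sym (cong₂ _*_ (matrix-tree ends P? P⇔ x 0≤x) (matrix-tree ends P? P⇔ y 0≤y)))
  (sym (cong sq (matrix-tree ends P? P⇔ (midpoint x y) 0≤w)))
  (laplacian-log-concave ends x y 0≤x 0≤y 0≤w)
  where 0≤w = midpoint-nonneg 0≤x 0≤y

weight-cong : ∀ (T : Subset m) {x y} → (∀ j → x j ≡ y j) → weight T x ≡ weight T y
weight-cong []      x≡y = refl
weight-cong (s ∷ T) x≡y = cong₂ _*_ (cong (if s then_else 1ℚ) (x≡y zero)) (weight-cong T (x≡y ∘ suc))

∑weight-cong : ∀ (L : List (Subset m)) {x y} → (∀ j → x j ≡ y j) → ∑weight L x ≡ ∑weight L y
∑weight-cong List.[]      x≡y = refl
∑weight-cong (T List.∷ L) x≡y = cong₂ _+_ (weight-cong T x≡y) (∑weight-cong L x≡y)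

weight-nonneg : ∀ (T : Subset m) {x} → NonNeg x → 0ℚ ≤ weight T x
weight-nonneg []          0≤x = nonNegative⁻¹ 1ℚ
weight-nonneg (true ∷ T)  0≤x = *-nonneg (0≤x zero) (weight-nonneg T (0≤x ∘ suc))
weight-nonneg (false ∷ T) 0≤x = *-nonneg (nonNegative⁻¹ 1ℚ) (weight-nonneg T (0≤x ∘ suc))

∑weight-nonneg : ∀ (L : List (Subset m)) {x} → NonNeg x → 0ℚ ≤ ∑weight L x
∑weight-nonneg List.[]      0≤x = ≤-refl
∑weight-nonneg (T List.∷ L) 0≤x = +-nonneg (weight-nonneg T 0≤x) (∑weight-nonneg L 0≤x)

p≤∣p∣ : ∀ p → p ≤ ∣ p ∣
p≤∣p∣ p with ≤-total 0ℚ p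
... | inj₁ 0≤p = ≤-reflexive (sym (0≤p⇒∣p∣≡p 0≤p))
... | inj₂ p≤0 = ≤-trans p≤0 (0≤∣p∣ p)

weight-∣∣ : ∀ (T : Subset m) x → ∣ weight T x ∣ ≡ weight T (∣_∣ ∘ x)
weight-∣∣ []          x = refl
weight-∣∣ (true ∷ T)  x = trans (∣p*q∣≡∣p∣*∣q∣ (x zero) (weight T (x ∘ suc)))
  (cong (∣ x zero ∣ *_) (weight-∣∣ T (x ∘ suc)))
weight-∣∣ (false ∷ T) x = trans (∣p*q∣≡∣p∣*∣q∣ 1ℚ (weight T (x ∘ suc)))
  (cong (1ℚ *_) (weight-∣∣ T (x ∘ suc)))

-- Passing to absolute values only raises the sum, the harmless direction for an upper bound at `x`.
∑weight-≤-∣∣ : ∀ (L : List (Subset m)) x → ∑weight L x ≤ ∑weight L (∣_∣ ∘ x)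
∑weight-≤-∣∣ List.[]      x = ≤-refl
∑weight-≤-∣∣ (T List.∷ L) x = +-mono-≤
  (≤-trans (p≤∣p∣ (weight T x)) (≤-reflexive (weight-∣∣ T x))) (∑weight-≤-∣∣ L x)

seq-weight : ∀ (T : Subset m) (x : Vector ℝ m) i →
  seq (∏ (λ j → if lookup T j then x j else 1ℝ)) i ≡ weight T (λ j → seq (x j) i)
seq-weight []          x i = refl
seq-weight (true ∷ T)  x i = cong (seq (x zero) i *_) (seq-weight T (x ∘ suc) i)
seq-weight (false ∷ T) x i = cong (1ℚ *_) (seq-weight T (x ∘ suc) i)

treeSum : List (Subset m) → Vector ℝ m → ℝ
treeSum L x = List.foldr ℝ._+_ 0ℝ (List.map (λ T → ∏ (λ j → if lookup T j then x j else 1ℝ)) L)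

seq-treeSum : ∀ (L : List (Subset m)) x i → seq (treeSum L x) i ≡ ∑weight L (λ j → seq (x j) i)
seq-treeSum List.[]      x i = refl
seq-treeSum (T List.∷ L) x i = cong₂ _+_ (seq-weight T x i) (seq-treeSum L x i)

-- Descent along dyadic points

½^ : ℕ → ℚ
½^ zero    = 1ℚ
½^ (suc k) = ½ * ½^ k

½^-pos : ∀ k → 0ℚ < ½^ k
½^-pos zero    = positive⁻¹ 1ℚ
½^-pos (suc k) = half-pos (½^-pos k)

½^≤1 : ∀ k → ½^ k ≤ 1ℚ
½^≤1 zero    = ≤-refl
½^≤1 (suc k) = ≤-trans (*-monoˡ-≤-nonNeg ½ (½^≤1 k)) (toWitness {a? = ½ * 1ℚ ≤? 1ℚ} _)

segment : (Fin m → ℚ) → (Fin m → ℚ) → ℚ → Fin m → ℚ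
segment z x t j = z j + t * (x j - z j)

segment-nonneg : ∀ {z x : Fin m → ℚ} → NonNeg z → NonNeg x → ∀ {t} → 0ℚ ≤ t → t ≤ 1ℚ → NonNeg (segment z x t)
segment-nonneg {z = z} {x} 0≤z 0≤x {t} 0≤t t≤1 j = subst (0ℚ ≤_)
  (solve 3 (λ z x t → (con 1ℚ :- t) :* z :+ t :* x := z :+ t :* (x :- z)) refl (z j) (x j) t)
  (+-nonneg (*-nonneg (p≤q⇒0≤q-p t≤1) (0≤z j)) (*-nonneg 0≤t (0≤x j)))

-- Halving the distance to b along a log-concave sequence squares the ratio to b.
descent-step : ∀ {b c c′ w} → 0ℚ < b → 0ℚ ≤ c → 0ℚ ≤ c′ → w ≤ 1ℚ → c * b ≤ sq c′ →
  c′ * (1ℚ - w) ≤ b → c * (1ℚ - (w + w)) ≤ b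
descent-step {b} {c} {c′} {w} 0<b 0≤c 0≤c′ w≤1 cb≤c′² c′≤b = ≤-trans {_} {c * sq (1ℚ - w)}
  -- The Bernoulli inequality: `sq (1ℚ - w)` exceeds `1ℚ - (w + w)` by `sq w`.
  (≤-by (c * sq w) (*-nonneg 0≤c (sq-nonneg w))
    (solve 2 (λ c w → c :* ((con 1ℚ :- w) :* (con 1ℚ :- w)) :- c :* (con 1ℚ :- (w :+ w)) := c :* (w :* w))
      refl c w))
  (*-cancelʳ-≤-pos b {{positive 0<b}} (begin
    c * sq (1ℚ - w) * b          ≡⟨ solve 3 (λ c v b → c :* (v :* v) :* b := c :* b :* (v :* v)) refl c (1ℚ - w) b ⟩
    c * b * sq (1ℚ - w)          ≤⟨ *-monoʳ-≤-nonNeg (sq (1ℚ - w)) {{nonNegative (sq-nonneg (1ℚ - w))}} cb≤c′² ⟩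
    sq c′ * sq (1ℚ - w)          ≡⟨ solve 2 (λ c v → c :* c :* (v :* v) := c :* v :* (c :* v)) refl c′ (1ℚ - w) ⟩
    sq (c′ * (1ℚ - w))           ≤⟨ *-mono-≤-nonneg (*-nonneg 0≤c′ (p≤q⇒0≤q-p w≤1)) (<⇒≤ 0<b) c′≤b c′≤b ⟩
    b * b                        ∎))
  where open ≤-Reasoning

module Descent (L : List (Subset m)) (f-log-concave : LogConcave (∑weight L))
               {z x : Fin m → ℚ} (0≤z : NonNeg z) (0≤x : NonNeg x) (0<fz : 0ℚ < ∑weight L z) where

  f = ∑weight L

  c : ℕ → ℚ
  c k = f (segment z x (½^ k))

  0≤c : ∀ k → 0ℚ ≤ c k
  0≤c k = ∑weight-nonneg L (segment-nonneg 0≤z 0≤x (<⇒≤ (½^-pos k)) (½^≤1 k))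

  halve : ∀ k → c k * f z ≤ sq (c (suc k))
  halve k = subst (λ u → c k * f z ≤ sq u)
    (∑weight-cong L λ j → solve 3 (λ z x t → con ½ :* (z :+ t :* (x :- z) :+ z) := z :+ con ½ :* t :* (x :- z))
      refl (z j) (x j) (½^ k))
    (f-log-concave _ z (segment-nonneg 0≤z 0≤x (<⇒≤ (½^-pos k)) (½^≤1 k)) 0≤z)

  -- Undoing one halving doubles the relative defect, so a defect of `½^ k * η` at distance `½^ k`
  -- becomes exactly `η` at `x`.
  descend : ∀ k {η} → 0ℚ ≤ η → η ≤ 1ℚ → c k * (1ℚ - ½^ k * η) ≤ f z → f x * (1ℚ - η) ≤ f z
  descend zero {η} 0≤η η≤1 h = subst₂ (λ u v → u * (1ℚ - v) ≤ f z)
    (∑weight-cong L λ j → solve 2 (λ z x → z :+ con 1ℚ :* (x :- z) := x) refl (z j) (x j))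
    (*-identityˡ η) h
  descend (suc k) {η} 0≤η η≤1 h = descend k 0≤η η≤1 (subst (λ w → c k * (1ℚ - w) ≤ f z)
    (solve 2 (λ h η → con ½ :* h :* η :+ con ½ :* h :* η := h :* η) refl (½^ k) η)
    (descent-step 0<fz (0≤c k) (0≤c (suc k))
      (*-mono-≤-nonneg (<⇒≤ (½^-pos (suc k))) (nonNegative⁻¹ 1ℚ) (½^≤1 (suc k)) η≤1) (halve k) h))

  -- With `w = ½^ k * η`, the growth hypothesis and `β ≤ f z` give `c k ≤ f z * (1ℚ + w)`, and
  -- `(1ℚ + w) * (1ℚ - w) ≤ 1ℚ` starts the descent. The constants `β` and `A` replace `f z` and
  -- `f x`, which vary with the index of the samples.
  bound : ∀ k {η β A} → 0ℚ ≤ η → η ≤ 1ℚ → β ≤ f z → f x ≤ A →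
    c k ≤ f z + η * β * ½^ k → f x ≤ f z + A * η
  bound k {η} {β} {A} 0≤η η≤1 β≤fz fx≤A ck≤ = begin
    f x                        ≡⟨ solve 2 (λ u η → u := u :* (con 1ℚ :- η) :+ u :* η) refl (f x) η ⟩
    f x * (1ℚ - η) + f x * η  ≤⟨ +-mono-≤ (descend k 0≤η η≤1 initial) (*-monoʳ-≤-nonNeg η {{nonNegative 0≤η}} fx≤A) ⟩
    f z + A * η ∎
    where
    open ≤-Reasoning
    w = ½^ k * η
    0≤w = *-nonneg (<⇒≤ (½^-pos k)) 0≤η
    w≤1 : w ≤ 1ℚ
    w≤1 = *-mono-≤-nonneg (<⇒≤ (½^-pos k)) (nonNegative⁻¹ 1ℚ) (½^≤1 k) η≤1
    initial : c k * (1ℚ - w) ≤ f z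
    initial = begin
      c k * (1ℚ - w)
        ≤⟨ *-monoʳ-≤-nonNeg (1ℚ - w) {{nonNegative (p≤q⇒0≤q-p w≤1)}} (≤-trans ck≤
             (+-monoʳ-≤ (f z) (*-monoʳ-≤-nonNeg (½^ k) {{nonNegative (<⇒≤ (½^-pos k))}}
               (*-monoˡ-≤-nonNeg η {{nonNegative 0≤η}} β≤fz)))) ⟩
      (f z + η * f z * ½^ k) * (1ℚ - w)
        ≤⟨ ≤-by (f z * sq w) (*-nonneg (<⇒≤ 0<fz) (sq-nonneg w))
             (solve 3 (λ b η h → b :- (b :+ η :* b :* h) :* (con 1ℚ :- h :* η) := b :* (h :* η :* (h :* η)))
               refl (f z) η (½^ k)) ⟩
      f z ∎

-- Passage to the reals

Eventually : (ℕ → Set) → Set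
Eventually P = ∃ λ N → ∀ i → N ℕ.≤ i → P i

infixr 4 _⊗_

_⊗_ : ∀ {P Q} → Eventually P → Eventually Q → Eventually (λ i → P i × Q i)
(M , p) ⊗ (N , q) = M ℕ.⊔ N , λ i ≤i → let M≤i , N≤i = ⊔-split M N ≤i in p i M≤i , q i N≤i

eventually-map : ∀ {P Q : ℕ → Set} → (∀ {i} → P i → Q i) → Eventually P → Eventually Q
eventually-map P⇒Q (N , p) = N , λ i N≤i → P⇒Q (p i N≤i)

eventually-all : ∀ {P : Fin m → ℕ → Set} → (∀ j → Eventually (P j)) → Eventually (λ i → ∀ j → P j i)
eventually-all {zero}  p = 0 , λ _ _ ()
eventually-all {suc m} p = eventually-map
  (λ { (p₀ , ps) zero → p₀ ; (p₀ , ps) (suc j) → ps j }) (p zero ⊗ eventually-all (p ∘ suc))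

Null : (ℕ → ℚ) → Set
Null s = ∀ ε → 0ℚ < ε → Eventually (λ i → ∣ s i ∣ < ε)

null-cong : ∀ {s t} → (∀ i → s i ≡ t i) → Null s → Null t
null-cong s≡t s→0 ε 0<ε = eventually-map (λ {i} → subst (λ u → ∣ u ∣ < ε) (s≡t i)) (s→0 ε 0<ε)

null-+ : ∀ {s t} → Null s → Null t → Null (λ i → s i + t i)
null-+ {s} {t} s→0 t→0 ε 0<ε = eventually-map
  (λ {i} (∣s∣< , ∣t∣<) → ≤-<-trans (∣p+q∣≤∣p∣+∣q∣ (s i) (t i))
    (subst (∣ s i ∣ + ∣ t i ∣ <_) (halves ε) (+-mono-< ∣s∣< ∣t∣<)))
  (s→0 (½ * ε) (half-pos 0<ε) ⊗ t→0 (½ * ε) (half-pos 0<ε))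

null-neg : ∀ {s} → Null s → Null (-_ ∘ s)
null-neg {s} s→0 ε 0<ε = eventually-map (λ {i} → subst (_< ε) (sym (∣-p∣≡∣p∣ (s i)))) (s→0 ε 0<ε)

∑ℚ : (Fin m → ℚ) → ℚ
∑ℚ = Vector.foldr _+_ 0ℚ

null-∑ : ∀ {s : ℕ → Fin m → ℚ} → (∀ j → Null (λ i → s i j)) → Null (∑ℚ ∘ s)
null-∑ {zero}  s→0 ε 0<ε = 0 , λ _ _ → 0<ε
null-∑ {suc m} s→0 = null-+ (s→0 zero) (null-∑ (s→0 ∘ suc))

seq-∑ : ∀ (x : Vector ℝ m) i → seq (∑ x) i ≡ ∑ℚ (λ j → seq (x j) i)
seq-∑ {zero}  x i = refl
seq-∑ {suc m} x i = cong (seq (x zero) i +_) (seq-∑ (x ∘ suc) i)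

∑ℚ-cong : ∀ {x y : Fin m → ℚ} → (∀ j → x j ≡ y j) → ∑ℚ x ≡ ∑ℚ y
∑ℚ-cong {zero}  x≡y = refl
∑ℚ-cong {suc m} x≡y = cong₂ _+_ (x≡y zero) (∑ℚ-cong (x≡y ∘ suc))

∑ℚ-+ : ∀ (x y : Fin m → ℚ) → ∑ℚ (λ j → x j + y j) ≡ ∑ℚ x + ∑ℚ y
∑ℚ-+ {zero}  x y = refl
∑ℚ-+ {suc m} x y = trans (cong (x zero + y zero +_) (∑ℚ-+ (x ∘ suc) (y ∘ suc)))
  (solve 4 (λ a b c d → a :+ b :+ (c :+ d) := a :+ c :+ (b :+ d)) refl
    (x zero) (y zero) (∑ℚ (x ∘ suc)) (∑ℚ (y ∘ suc)))

∑ℚ-* : ∀ q (x : Fin m → ℚ) → ∑ℚ (λ j → q * x j) ≡ q * ∑ℚ x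
∑ℚ-* {zero}  q x = sym (*-zeroʳ q)
∑ℚ-* {suc m} q x = trans (cong (q * x zero +_) (∑ℚ-* q (x ∘ suc))) (sym (*-distribˡ-+ q (x zero) (∑ℚ (x ∘ suc))))

∣∣-null : ∀ {x} → 0ℝ ℝ.≤ x → Null (λ i → ∣ seq x i ∣ - seq x i)
∣∣-null {x} 0≤x ε 0<ε = eventually-map (λ {i} → near (seq x i)) (0≤x δ 0<δ)
  where
  -- For negative `p` the difference is `-2p`, at most `2δ = ½ε`; the other half of `ε` makes the
  -- bound strict.
  δ = ½ * (½ * ε)
  0<δ = half-pos (half-pos 0<ε)
  near : ∀ p → 0ℚ ≤ p + δ → ∣ ∣ p ∣ - p ∣ < ε
  near p 0≤p+δ with ≤-total 0ℚ p
  ... | inj₁ 0≤p = subst (_< ε) (cong ∣_∣ (sym (trans (cong (_- p) (0≤p⇒∣p∣≡p 0≤p)) (+-inverseʳ p)))) 0<ε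
  ... | inj₂ p≤0 = begin-strict
    ∣ ∣ p ∣ - p ∣     ≡⟨ 0≤p⇒∣p∣≡p (p≤q⇒0≤q-p (p≤∣p∣ p)) ⟩
    ∣ p ∣ - p         ≡⟨ cong (_- p) (trans (sym (∣-p∣≡∣p∣ p)) (0≤p⇒∣p∣≡p (neg-antimono-≤ p≤0))) ⟩
    - p - p           ≤⟨ ≤-by (p + δ + (p + δ)) (+-nonneg 0≤p+δ 0≤p+δ)
                           (solve 2 (λ p ε → con ½ :* ε :- (:- p :- p)
                              := p :+ con ½ :* (con ½ :* ε) :+ (p :+ con ½ :* (con ½ :* ε))) refl p ε) ⟩
    ½ * ε             ≡⟨ +-identityˡ (½ * ε) ⟨
    0ℚ + ½ * ε        <⟨ +-monoˡ-< (½ * ε) (half-pos 0<ε) ⟩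
    ½ * ε + ½ * ε     ≡⟨ halves ε ⟩
    ε                 ∎
    where open ≤-Reasoning

-- The direction from z to x, with |x| in place of x so that every
-- rational approximation is nonnegative.
direction : Vector ℝ m → Vector ℝ m → Vector ℝ m
direction z x j = ℝ.∣ x j ∣ ℝ.- z j

-- The sum splits into the errors of replacing `x` by its absolute value and the deviations of `∑ x`
-- and `∑ z` from `s`, all of them null.
direction-null : ∀ {z x : Vector ℝ m} {s} → (∀ j → 0ℝ ℝ.≤ x j) → ∑ x ℝ.≈ s → ∑ z ℝ.≈ s →
  Null (λ i → ∑ℚ (λ j → seq (direction z x j) i))
direction-null {z = z} {x} {s} 0≤x ∑x≈s ∑z≈s = null-cong
  (λ i → begin
    ∑ℚ (λ j → ∣ X i j ∣ - X i j) + (seq (∑ x) i - seq s i + - (seq (∑ z) i - seq s i))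
      ≡⟨ cong₂ (λ u v → ∑ℚ (λ j → ∣ X i j ∣ - X i j) + (u - seq s i + - (v - seq s i))) (seq-∑ x i) (seq-∑ z i) ⟩
    ∑ℚ (λ j → ∣ X i j ∣ - X i j) + (∑ℚ (X i) - seq s i + - (∑ℚ (Z i) - seq s i))
      ≡⟨ solve 4 (λ a x z s → a :+ (x :- s :+ (:- (z :- s))) := a :+ x :+ con (- 1ℚ) :* z) refl
           (∑ℚ (λ j → ∣ X i j ∣ - X i j)) (∑ℚ (X i)) (∑ℚ (Z i)) (seq s i) ⟩
    ∑ℚ (λ j → ∣ X i j ∣ - X i j) + ∑ℚ (X i) + - 1ℚ * ∑ℚ (Z i)
      ≡⟨ cong₂ _+_ (∑ℚ-+ (λ j → ∣ X i j ∣ - X i j) (X i)) (∑ℚ-* (- 1ℚ) (Z i)) ⟨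
    ∑ℚ (λ j → ∣ X i j ∣ - X i j + X i j) + ∑ℚ (λ j → - 1ℚ * Z i j)
      ≡⟨ ∑ℚ-+ (λ j → ∣ X i j ∣ - X i j + X i j) (λ j → - 1ℚ * Z i j) ⟨
    ∑ℚ (λ j → ∣ X i j ∣ - X i j + X i j + - 1ℚ * Z i j)
      ≡⟨ ∑ℚ-cong (λ j → solve 3 (λ a x z → a :- x :+ x :+ con (- 1ℚ) :* z := a :- z) refl
           ∣ X i j ∣ (X i j) (Z i j)) ⟩
    ∑ℚ (λ j → ∣ X i j ∣ - Z i j) ∎)
  (null-+ (null-∑ λ j → ∣∣-null {x j} (0≤x j)) (null-+ ∑x≈s (null-neg ∑z≈s)))
  where
  open ≡-Reasoning
  X Z : ℕ → Fin _ → ℚ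
  X i j = seq (x j) i
  Z i j = seq (z j) i

-- This is where interiority enters: one tree bounds the whole tree sum at `Z i` away from 0,
-- uniformly in `i`.
weight-bounded-below : ∀ (T : Subset m) {Z : ℕ → Fin m → ℚ} →
  (∀ j → ∃ λ β → 0ℚ < β × Eventually (λ i → β ≤ Z i j)) →
  ∃ λ β → 0ℚ < β × Eventually (λ i → β ≤ weight T (Z i))
weight-bounded-below [] bounds = 1ℚ , positive⁻¹ 1ℚ , 0 , λ _ _ → ≤-refl
weight-bounded-below (s ∷ T) {Z} bounds with factor s | weight-bounded-below T {λ i → Z i ∘ suc} (bounds ∘ suc)
  where
  factor : ∀ s → ∃ λ β → 0ℚ < β × Eventually (λ i → β ≤ (if s then Z i zero else 1ℚ))
  factor true  = bounds zero
  factor false = 1ℚ , positive⁻¹ 1ℚ , 0 , λ _ _ → ≤-refl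
... | β , 0<β , β≤ | γ , 0<γ , γ≤ = β * γ
  , positive⁻¹ (β * γ) {{pos*pos⇒pos β {{positive 0<β}} γ {{positive 0<γ}}}}
  , eventually-map (λ (β≤ , γ≤) → *-mono-≤-nonneg (<⇒≤ 0<β) (≤-trans (<⇒≤ 0<γ) γ≤) β≤ γ≤) (β≤ ⊗ γ≤)

≤-+-nonneg : ∀ {p q} → 0ℚ ≤ q → p ≤ p + q
≤-+-nonneg {p} {q} 0≤q = subst (_≤ p + q) (+-identityʳ p) (+-monoʳ-≤ p 0≤q)

≤-maximal : ∀ {A ε η} → 0ℚ ≤ A → 0ℚ < ε → (A + ε) * η ≡ ε → η ≤ 1ℚ
≤-maximal {A} {ε} {η} 0≤A 0<ε eq = *-cancelˡ-≤-pos (A + ε) {{nonNeg+pos⇒pos A {{nonNegative 0≤A}} ε {{positive 0<ε}}}}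
  (subst₂ _≤_ (sym eq) (sym (*-identityʳ (A + ε)))
    (subst (_≤ A + ε) (+-identityˡ ε) (+-monoˡ-≤ ε 0≤A)))

-- The one-sided form of "the derivative of f at Z in the direction X - Z is ≤ 0".
NoAscent : ((Fin m → ℚ) → ℚ) → (Z X : ℕ → Fin m → ℚ) → Set
NoAscent f Z X = ∀ ε → 0ℚ < ε → ∃ λ k → Eventually λ i →
  f (segment (Z i) (X i) (½^ k)) ≤ f (Z i) + ε * ½^ k

-- An empty list gives two zero sums. Otherwise the first tree supplies the positive lower bound
-- `β`, and `Descent.bound` applies at every late index.
noAscent⇒≤ : ∀ (L : List (Subset m)) → LogConcave (∑weight L) → ∀ {Z X : ℕ → Fin m → ℚ} →
  (∀ j → ∃ λ β → 0ℚ < β × Eventually (λ i → β ≤ Z i j)) → (∀ i → NonNeg (X i)) →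
  (∃ λ A → 0ℚ ≤ A × Eventually (λ i → ∑weight L (X i) ≤ A)) →
  NoAscent (∑weight L) Z X →
  ∀ ε → 0ℚ < ε → Eventually (λ i → ∑weight L (X i) ≤ ∑weight L (Z i) + ε)
noAscent⇒≤ List.[] _ _ _ _ _ ε 0<ε = 0 , λ i _ → subst (0ℚ ≤_) (sym (+-identityˡ ε)) (<⇒≤ 0<ε)
noAscent⇒≤ L@(T List.∷ K) log-concave {Z} {X} Z≥ 0≤X (A , 0≤A , ≤A) noAscent ε 0<ε
  with weight-bounded-below T Z≥
     -- `η = ε / (A + ε)` satisfies both `η ≤ 1ℚ` and `A * η ≤ ε`.
     | shrink (A + ε) (nonNeg+pos⇒pos A {{nonNegative 0≤A}} ε {{positive 0<ε}}) ε 0<ε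
... | β , 0<β , β≤ | η , 0<η , eq
  -- The slope must be chosen before the index, hence `η * β` and not `η` times the sum at `Z i`.
  with noAscent (η * β) (positive⁻¹ (η * β) {{pos*pos⇒pos η {{positive 0<η}} β {{positive 0<β}}}})
...   | k , ascent≤ = eventually-map
  (λ {i} (0≤Zi , β≤wZ , fX≤A , ascent≤i) →
    let β≤fZ = ≤-trans β≤wZ (≤-+-nonneg (∑weight-nonneg K 0≤Zi)) in ≤-trans
      (Descent.bound L log-concave 0≤Zi (0≤X i) (<-≤-trans 0<β β≤fZ)
        k (<⇒≤ 0<η) (≤-maximal 0≤A 0<ε eq) β≤fZ fX≤A ascent≤i)
      (+-monoʳ-≤ (∑weight L (Z i)) Aη≤ε))
  (0≤Z ⊗ β≤ ⊗ ≤A ⊗ ascent≤)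
  where
  0≤Z : Eventually (λ i → NonNeg (Z i))
  0≤Z = eventually-all λ j → let β , 0<β , β≤ = Z≥ j in eventually-map (≤-trans (<⇒≤ 0<β)) β≤
  Aη≤ε : A * η ≤ ε
  Aη≤ε = ≤-trans (*-monoʳ-≤-nonNeg η {{nonNegative (<⇒≤ 0<η)}} (≤-+-nonneg {A} (<⇒≤ 0<ε))) (≤-reflexive eq)

-- The Archimedean property

-- A recursive form of `+ n / 1`: inductions and the ring solver see `1ℚ + ι n` instead of a
-- normalised fraction.
ι : ℕ → ℚ
ι zero    = 0ℚ
ι (suc n) = 1ℚ + ι n

private
  ι-mkℚ : ∀ n → ι n ≡ mkℚ (ℤ.+ n) 0 (Coprime.sym (Coprime.1-coprimeTo n))
  ι-mkℚ zero    = refl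
  ι-mkℚ (suc n) = trans (cong (1ℚ +_) (ι-mkℚ n)) (trans
    (cong (λ a → a / 1) (cong (λ a → ℤ.+ 1 ℤ.+ a) (ℤ.*-identityʳ (ℤ.+ n))))
    (normalize-coprime (Coprime.sym (Coprime.1-coprimeTo (suc n)))))

ι≡/1 : ∀ n → ι n ≡ ℤ.+ n / 1
ι≡/1 n = trans (ι-mkℚ n) (sym (normalize-coprime (Coprime.sym (Coprime.1-coprimeTo n))))

archimedean : ∀ p → ∃ λ n → p ≤ ι n
archimedean p@(mkℚ (ℤ.+ a) d _) = a , subst (p ≤_) (sym (ι-mkℚ a))
  (*≤* (ℤ.*-monoˡ-≤-nonNeg (ℤ.+ a) (ℤ.+≤+ (s≤s z≤n))))
archimedean p@(mkℚ ℤ.-[1+ a ] d _) = 0 , nonPositive⁻¹ p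

ι-nonneg : ∀ n → 0ℚ ≤ ι n
ι-nonneg zero    = ≤-refl
ι-nonneg (suc n) = +-nonneg (nonNegative⁻¹ 1ℚ) (ι-nonneg n)

ι*½^≤1 : ∀ n → ι n * ½^ n ≤ 1ℚ
ι*½^≤1 zero    = nonNegative⁻¹ 1ℚ
ι*½^≤1 (suc n) = subst₂ _≤_
  (solve 2 (λ a h → con ½ :* h :+ con ½ :* (a :* h) := (con 1ℚ :+ a) :* (con ½ :* h)) refl (ι n) (½^ n))
  refl
  (+-mono-≤ (*-monoˡ-≤-nonNeg ½ (½^≤1 n)) (*-monoˡ-≤-nonNeg ½ (ι*½^≤1 n)))

½^-small : ∀ q → 0ℚ < q → ∃ λ k → ½^ k ≤ q
½^-small q 0<q with shrink q (positive 0<q) 1ℚ (positive⁻¹ 1ℚ)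
... | p , 0<p , qp≡1 with archimedean p
... | n , p≤n = n , (begin
  ½^ n              ≡⟨ *-identityˡ (½^ n) ⟨
  1ℚ * ½^ n         ≡⟨ cong (_* ½^ n) qp≡1 ⟨
  q * p * ½^ n      ≡⟨ *-assoc q p (½^ n) ⟩
  q * (p * ½^ n)    ≤⟨ *-monoˡ-≤-nonNeg q {{nonNegative (<⇒≤ 0<q)}} (≤-trans
                         (*-monoʳ-≤-nonNeg (½^ n) {{nonNegative (<⇒≤ (½^-pos n))}} p≤n) (ι*½^≤1 n)) ⟩
  q * 1ℚ            ≡⟨ *-identityʳ q ⟩
  q                 ∎)
  where open ≤-Reasoning

-- From real derivatives to rational samples

samples ∣samples∣ : Vector ℝ m → ℕ → Fin m → ℚ
samples   x i j = seq (x j) i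
∣samples∣ x i j = ∣ seq (x j) i ∣

noAscent⇒treeSum≤ : ∀ (L : List (Subset m)) → LogConcave (∑weight L) → ∀ {z x} → (∀ j → 0ℝ ℝ.< z j) →
  NoAscent (∑weight L) (samples z) (∣samples∣ x) → treeSum L x ℝ.≤ treeSum L z
noAscent⇒treeSum≤ L log-concave {z} {x} 0<z noAscent ε 0<ε = eventually-map
  (λ {i} ≤+ε → subst₂ (λ u v → u ≤ v + ε) (sym (seq-treeSum L x i)) (sym (seq-treeSum L z i))
    (≤-trans (∑weight-≤-∣∣ L (samples x i)) ≤+ε))
  (noAscent⇒≤ L log-concave bounded-below (λ i j → 0≤∣p∣ (seq (x j) i)) bounded noAscent ε 0<ε)
  where
  bounded-below : ∀ j → ∃ λ β → 0ℚ < β × Eventually (λ i → β ≤ samples z i j)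
  bounded-below j = let β , 0<β , β≤ = 0<z j in
    β , 0<β , eventually-map (λ {i} → subst (_≤ samples z i j) (+-identityˡ β)) β≤

  -- The tree sum at the absolute values is itself a real, so its Cauchy sequence is eventually
  -- bounded.
  bounded : ∃ λ A → 0ℚ ≤ A × Eventually (λ i → ∑weight L (∣samples∣ x i) ≤ A)
  bounded = let s = treeSum L (ℝ.∣_∣ ∘ x) ; A , A>0 , ∣s∣≤A = eventually-bounded (seq s) (cauchy s) in
    A , <⇒≤ (positive⁻¹ A {{A>0}}) , eventually-map
      (λ {i} ∣s∣≤A → ≤-trans (p≤∣p∣ _) (subst (λ u → ∣ u ∣ ≤ A) (seq-treeSum L (ℝ.∣_∣ ∘ x) i) ∣s∣≤A)) ∣s∣≤A

0<fromℚ : ∀ {q} → 0ℚ < q → 0ℝ ℝ.< fromℚ q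
0<fromℚ {q} 0<q = q , 0<q , 0 , λ _ _ → ≤-reflexive (+-identityˡ q)

private
  extract-bound : ∀ {p q h γ ε} → 0ℚ ≤ h → 0ℚ < γ → ∣ p - q - h * 0ℚ ∣ + γ ≤ ε * ∣ h ∣ → p ≤ q + ε * h
  extract-bound {p} {q} {h} {γ} {ε} 0≤h 0<γ bound = begin
    p                          ≡⟨ solve 3 (λ p q h → p := q :+ (p :- q :- h :* con 0ℚ)) refl p q h ⟩
    q + (p - q - h * 0ℚ)       ≤⟨ +-monoʳ-≤ q (≤-trans (p≤∣p∣ (p - q - h * 0ℚ)) (≤-trans (≤-+-nonneg (<⇒≤ 0<γ)) bound)) ⟩
    q + ε * ∣ h ∣              ≡⟨ cong (λ u → q + ε * u) (0≤p⇒∣p∣≡p 0≤h) ⟩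
    q + ε * h                  ∎
    where open ≤-Reasoning

-- The derivative is tested at the constant real `t = ½^ k`, so that all samples share the same
-- step, and the upper half of the estimate is read off.
critical⇒noAscent : ∀ (L : List (Subset m)) {z x} →
  HasDirectionalDerivative (treeSum L) z (direction z x) 0ℝ →
  NoAscent (∑weight L) (samples z) (∣samples∣ x)
critical⇒noAscent L {z} {x} derivative ε 0<ε = k , N , λ i N≤i →
  extract-bound {ε = ε} (<⇒≤ (½^-pos k)) 0<γ (subst₂ (λ u v → ∣ u - v - h * 0ℚ ∣ + γ ≤ ε * ∣ h ∣)
    (seq-treeSum L (λ j → z j ℝ.+ fromℚ h ℝ.* direction z x j) i) (seq-treeSum L z i) (bound i N≤i))
  where
  limit = derivative (fromℚ ε) (0<fromℚ 0<ε)
  δ₀  = proj₁ limit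
  q   = proj₁ (proj₁ (proj₂ limit))
  0<q : 0ℚ < q
  0<q = proj₁ (proj₂ (proj₁ (proj₂ limit)))
  q≤δ₀ : Eventually (λ i → 0ℚ + q ≤ seq δ₀ i)
  q≤δ₀ = proj₂ (proj₂ (proj₁ (proj₂ limit)))
  -- `q` is an eventual lower bound of `δ₀`; a step of at most half of it leaves the gap `½ * q`
  -- that strict inequality of reals asks for.
  k = proj₁ (½^-small (½ * q) (half-pos 0<q))
  h = ½^ k
  ∣h∣≡h : ∣ h ∣ ≡ h
  ∣h∣≡h = 0≤p⇒∣p∣≡p (<⇒≤ (½^-pos k))
  0<∣t∣ : 0ℝ ℝ.< ℝ.∣ fromℚ h ∣
  0<∣t∣ = h , ½^-pos k , 0 , λ _ _ → ≤-reflexive (trans (+-identityˡ h) (sym ∣h∣≡h))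
  ∣t∣<δ₀ : ℝ.∣ fromℚ h ∣ ℝ.< δ₀
  ∣t∣<δ₀ = ½ * q , half-pos 0<q , eventually-map
    (≤-trans (subst₂ _≤_ (cong (_+ ½ * q) (sym ∣h∣≡h)) (trans (halves q) (sym (+-identityˡ q)))
      (+-monoˡ-≤ (½ * q) (proj₂ (½^-small (½ * q) (half-pos 0<q)))))) q≤δ₀
  small = proj₂ (proj₂ limit) (fromℚ h) 0<∣t∣ ∣t∣<δ₀
  γ = proj₁ small
  0<γ : 0ℚ < γ
  0<γ = proj₁ (proj₂ small)
  N = proj₁ (proj₂ (proj₂ small))
  bound = proj₂ (proj₂ (proj₂ small))

-- Equiarboreal graphs

uniform-bound : ∀ {s : ℕ → Fin m → ℚ} → (∀ j → IsCauchy (λ i → s i j)) →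
  ∃ λ B → 0ℚ ≤ B × Eventually (λ i → ∀ j → ∣ s i j ∣ ≤ B)
uniform-bound {zero}  c = 0ℚ , ≤-refl , 0 , λ _ _ ()
uniform-bound {suc m} {s} c =
  let A , A>0 , ∣s₀∣≤A = eventually-bounded (λ i → s i zero) (c zero)
      B , 0≤B , ∣s∣≤B  = uniform-bound (c ∘ suc)
      0≤A = <⇒≤ (positive⁻¹ A {{A>0}})
  in A + B , +-nonneg 0≤A 0≤B , eventually-map
       (λ { (≤A , ≤B) zero    → ≤-trans ≤A (≤-+-nonneg 0≤B)
          ; (≤A , ≤B) (suc j) → ≤-trans (≤B j) (subst (_≤ A + B) (+-identityˡ B) (+-monoˡ-≤ B 0≤A)) })
       (∣s₀∣≤A ⊗ ∣s∣≤B)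

restrict : Subset m → (Fin m → ℚ) → Fin m → ℚ
restrict T y j = if lookup T j then y j else 0ℚ

∣∑restrict∣≤ : ∀ (T : Subset m) {y B} → (∀ j → ∣ y j ∣ ≤ B) → 0ℚ ≤ B → ∣ ∑ℚ (restrict T y) ∣ ≤ ι m * B
∣∑restrict∣≤ []          {y} {B} ≤B 0≤B = ≤-reflexive (sym (*-zeroˡ B))
∣∑restrict∣≤ {suc m} (s ∷ T) {y} {B} ≤B 0≤B = begin
  ∣ y₀ s + ∑ℚ (restrict T (y ∘ suc)) ∣      ≤⟨ ∣p+q∣≤∣p∣+∣q∣ (y₀ s) (∑ℚ (restrict T (y ∘ suc))) ⟩
  ∣ y₀ s ∣ + ∣ ∑ℚ (restrict T (y ∘ suc)) ∣  ≤⟨ +-mono-≤ (∣y₀∣≤B s) (∣∑restrict∣≤ T (≤B ∘ suc) 0≤B) ⟩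
  B + ι m * B                               ≡⟨ solve 2 (λ a b → b :+ a :* b := (con 1ℚ :+ a) :* b) refl (ι m) B ⟩
  ι (suc m) * B                             ∎
  where
  open ≤-Reasoning
  y₀ : Bool → ℚ
  y₀ s = if s then y zero else 0ℚ
  ∣y₀∣≤B : ∀ s → ∣ y₀ s ∣ ≤ B
  ∣y₀∣≤B true  = ≤B zero
  ∣y₀∣≤B false = 0≤B

-- Bounds the terms of order ≥ 2 in ∏ (1 + t yⱼ) / t².
quadratic : ℚ → ℕ → ℚ
quadratic B zero    = 0ℚ
quadratic B (suc m) = quadratic B m + B * (quadratic B m + ι m * B)

quadratic-nonneg : ∀ {B} m → 0ℚ ≤ B → 0ℚ ≤ quadratic B m
quadratic-nonneg zero    0≤B = ≤-refl
quadratic-nonneg (suc m) 0≤B = +-nonneg (quadratic-nonneg m 0≤B)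
  (*-nonneg 0≤B (+-nonneg (quadratic-nonneg m 0≤B) (*-nonneg (ι-nonneg m) 0≤B)))

*-≤-∣∣ : ∀ {p q P Q} → ∣ p ∣ ≤ P → ∣ q ∣ ≤ Q → p * q ≤ P * Q
*-≤-∣∣ {p} {q} {P} {Q} p≤P q≤Q = begin
  p * q          ≤⟨ p≤∣p∣ (p * q) ⟩
  ∣ p * q ∣      ≡⟨ ∣p*q∣≡∣p∣*∣q∣ p q ⟩
  ∣ p ∣ * ∣ q ∣  ≤⟨ *-mono-≤-nonneg (0≤∣p∣ p) (≤-trans (0≤∣p∣ q) q≤Q) p≤P q≤Q ⟩
  P * Q          ∎
  where open ≤-Reasoning

-- First-order expansion around the all-ones point, one factor at a time. Nonnegativity of each
-- factor allows multiplying the inductive bound by it.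
weight-expansion : ∀ (T : Subset m) {y B t} → (∀ j → ∣ y j ∣ ≤ B) → 0ℚ ≤ B → 0ℚ ≤ t → t ≤ 1ℚ →
  NonNeg (λ j → 1ℚ + t * y j) →
  weight T (λ j → 1ℚ + t * y j) ≤ 1ℚ + t * ∑ℚ (restrict T y) + sq t * quadratic B m
weight-expansion [] {t = t} ≤B 0≤B 0≤t t≤1 0≤1+ty = ≤-reflexive
  (solve 1 (λ t → con 1ℚ := con 1ℚ :+ t :* con 0ℚ :+ t :* t :* con 0ℚ) refl t)
weight-expansion {suc m} (false ∷ T) {y} {B} {t} ≤B 0≤B 0≤t t≤1 0≤1+ty = begin
  1ℚ * weight T (λ j → 1ℚ + t * y (suc j))
    ≡⟨ *-identityˡ _ ⟩
  weight T (λ j → 1ℚ + t * y (suc j))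
    ≤⟨ weight-expansion T (≤B ∘ suc) 0≤B 0≤t t≤1 (0≤1+ty ∘ suc) ⟩
  1ℚ + t * S + sq t * C
    -- An edge outside the tree contributes nothing; the bound is padded so that it depends on the
    -- number of edges only.
    ≤⟨ ≤-by (sq t * (B * (C + ι m * B))) (*-nonneg (sq-nonneg t)
         (*-nonneg 0≤B (+-nonneg (quadratic-nonneg m 0≤B) (*-nonneg (ι-nonneg m) 0≤B))))
         (solve 5 (λ t S C B a → con 1ℚ :+ t :* (con 0ℚ :+ S) :+ t :* t :* (C :+ B :* (C :+ a :* B))
              :- (con 1ℚ :+ t :* S :+ t :* t :* C) := t :* t :* (B :* (C :+ a :* B))) refl t S C B (ι m)) ⟩
  1ℚ + t * (0ℚ + S) + sq t * quadratic B (suc m) ∎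
  where
  open ≤-Reasoning
  S = ∑ℚ (restrict T (y ∘ suc))
  C = quadratic B m
weight-expansion {suc m} (true ∷ T) {y} {B} {t} ≤B 0≤B 0≤t t≤1 0≤1+ty = begin
  (1ℚ + t * y zero) * weight T (λ j → 1ℚ + t * y (suc j))
    ≤⟨ *-monoˡ-≤-nonNeg (1ℚ + t * y zero) {{nonNegative (0≤1+ty zero)}}
         (weight-expansion T (≤B ∘ suc) 0≤B 0≤t t≤1 (0≤1+ty ∘ suc)) ⟩
  (1ℚ + t * y zero) * (1ℚ + t * S + sq t * C)
    ≡⟨ solve 4 (λ t y S C → (con 1ℚ :+ t :* y) :* (con 1ℚ :+ t :* S :+ t :* t :* C)
         := con 1ℚ :+ t :* (y :+ S) :+ t :* t :* (C :+ (t :* y :* C :+ y :* S))) refl t (y zero) S C ⟩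
  1ℚ + t * (y zero + S) + sq t * (C + (t * y zero * C + y zero * S))
    -- Of the two second-order terms, `t ≤ 1ℚ` absorbs the spare factor `t` in the first, and the
    -- second is a product of two bounded quantities.
    ≤⟨ +-monoʳ-≤ (1ℚ + t * (y zero + S)) (*-monoˡ-≤-nonNeg (sq t) {{nonNegative (sq-nonneg t)}}
         (+-monoʳ-≤ C (+-mono-≤
           (*-monoʳ-≤-nonNeg C {{nonNegative (quadratic-nonneg m 0≤B)}} ty≤B)
           (*-≤-∣∣ (≤B zero) (∣∑restrict∣≤ T (≤B ∘ suc) 0≤B))))) ⟩
  1ℚ + t * (y zero + S) + sq t * (C + (B * C + B * (ι m * B)))
    ≡⟨ cong (λ u → 1ℚ + t * (y zero + S) + sq t * (C + u)) (*-distribˡ-+ B C (ι m * B)) ⟨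
  1ℚ + t * (y zero + S) + sq t * quadratic B (suc m) ∎
  where
  open ≤-Reasoning
  S = ∑ℚ (restrict T (y ∘ suc))
  C = quadratic B m
  ty≤B : t * y zero ≤ B
  ty≤B = subst (t * y zero ≤_) (*-identityˡ B) (*-≤-∣∣ (subst (_≤ 1ℚ) (sym (0≤p⇒∣p∣≡p 0≤t)) t≤1) (≤B zero))

weight-1 : (T : Subset m) → weight T (λ _ → 1ℚ) ≡ 1ℚ
weight-1 []          = refl
weight-1 (true ∷ T)  = trans (*-identityˡ _) (weight-1 T)
weight-1 (false ∷ T) = trans (*-identityˡ _) (weight-1 T)

∑∑restrict : List (Subset m) → (Fin m → ℚ) → ℚ
∑∑restrict L y = List.foldr (λ T s → ∑ℚ (restrict T y) + s) 0ℚ L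

∑weight-expansion : ∀ (L : List (Subset m)) {y B t} → (∀ j → ∣ y j ∣ ≤ B) → 0ℚ ≤ B → 0ℚ ≤ t → t ≤ 1ℚ →
  NonNeg (λ j → 1ℚ + t * y j) →
  ∑weight L (λ j → 1ℚ + t * y j) ≤
    ∑weight L (λ _ → 1ℚ) + t * ∑∑restrict L y + sq t * (ι (length L) * quadratic B m)
∑weight-expansion {m} List.[] {B = B} {t} ≤B 0≤B 0≤t t≤1 0≤1+ty = ≤-reflexive
  (solve 2 (λ t C → con 0ℚ := con 0ℚ :+ t :* con 0ℚ :+ t :* t :* (con 0ℚ :* C)) refl t (quadratic B m))
∑weight-expansion {m} (T List.∷ L) {y} {B} {t} ≤B 0≤B 0≤t t≤1 0≤1+ty = begin
  weight T (λ j → 1ℚ + t * y j) + ∑weight L (λ j → 1ℚ + t * y j)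
    ≤⟨ +-mono-≤ (weight-expansion T ≤B 0≤B 0≤t t≤1 0≤1+ty) (∑weight-expansion L ≤B 0≤B 0≤t t≤1 0≤1+ty) ⟩
  1ℚ + t * s + sq t * C + (W + t * S + sq t * (ι (length L) * C))
    ≡⟨ solve 6 (λ t s C W S a → con 1ℚ :+ t :* s :+ t :* t :* C :+ (W :+ t :* S :+ t :* t :* (a :* C))
         := con 1ℚ :+ W :+ t :* (s :+ S) :+ t :* t :* ((con 1ℚ :+ a) :* C)) refl t s C W S (ι (length L)) ⟩
  1ℚ + W + t * (s + S) + sq t * (ι (suc (length L)) * C)
    ≡⟨ cong (λ u → u + W + t * (s + S) + sq t * (ι (suc (length L)) * C)) (weight-1 T) ⟨
  weight T (λ _ → 1ℚ) + W + t * (s + S) + sq t * (ι (suc (length L)) * C) ∎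
  where
  open ≤-Reasoning
  s = ∑ℚ (restrict T y)
  S = ∑∑restrict L y
  W = ∑weight L (λ _ → 1ℚ)
  C = quadratic B m

count : Fin m → List (Subset m) → ℕ
count e L = length (filter (e Subset.∈?_) L)

-- Double counting of the pairs of a tree and an edge in it.
∑∑restrict-count : ∀ (L : List (Subset m)) y → ∑∑restrict L y ≡ ∑ℚ (λ e → ι (count e L) * y e)
∑∑restrict-count List.[] y = sym (trans (∑ℚ-* 0ℚ y) (*-zeroˡ (∑ℚ y)))
∑∑restrict-count (T List.∷ L) y = begin
  ∑ℚ (restrict T y) + ∑∑restrict L y                   ≡⟨ cong (∑ℚ (restrict T y) +_) (∑∑restrict-count L y) ⟩
  ∑ℚ (restrict T y) + ∑ℚ (λ e → ι (count e L) * y e)   ≡⟨ ∑ℚ-+ (restrict T y) _ ⟨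
  ∑ℚ (λ e → restrict T y e + ι (count e L) * y e)      ≡⟨ ∑ℚ-cong step ⟩
  ∑ℚ (λ e → ι (count e (T List.∷ L)) * y e)            ∎
  where
  open ≡-Reasoning
  step : ∀ e → restrict T y e + ι (count e L) * y e ≡ ι (count e (T List.∷ L)) * y e
  step e with e Subset.∈? T
  ... | yes e∈T rewrite Vec.[]=⇒lookup e∈T =
    solve 2 (λ a y → y :+ a :* y := (con 1ℚ :+ a) :* y) refl (ι (count e L)) (y e)
  ... | no e∉T with lookup T e in eq
  ...   | true  = contradiction (Vec.lookup⇒[]= e T eq) e∉T
  ...   | false = +-identityˡ (ι (count e L) * y e)

constant : ∀ (c : Fin m → ℕ) → (∀ e f → c e ≡ c f) → ∃ λ κ → ∀ e → c e ≡ κ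
-- Without edges any value serves.
constant {zero}  c c≡ = 0 , λ ()
constant {suc m} c c≡ = c zero , λ e → c≡ e zero

shrink-≤ : ∀ {A δ p ε} → 0ℚ ≤ A → 0ℚ ≤ δ → (A + 1ℚ) * δ ≡ ε → p ≤ δ → A * p ≤ ε
shrink-≤ {A} {δ} {p} {ε} 0≤A 0≤δ eq p≤δ = begin
  A * p         ≤⟨ *-monoˡ-≤-nonNeg A {{nonNegative 0≤A}} p≤δ ⟩
  A * δ         ≤⟨ *-monoʳ-≤-nonNeg δ {{nonNegative 0≤δ}} (≤-+-nonneg {A} (nonNegative⁻¹ 1ℚ)) ⟩
  (A + 1ℚ) * δ  ≡⟨ eq ⟩
  ε             ∎
  where open ≤-Reasoning

-- Equal counts turn the linear term into `ι κ` times the coordinate sum of the direction, which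
-- tends to 0. The quadratic term is controlled by the step `h`, chosen before the index; each gets
-- half of `ε`.
equiarboreal⇒noAscent : ∀ (L : List (Subset m)) → (∀ e f → count e L ≡ count f L) →
  ∀ x → Null (λ i → ∑ℚ (λ j → ∣ seq (x j) i ∣ - 1ℚ)) →
  NoAscent (∑weight L) (λ _ _ → 1ℚ) (∣samples∣ x)
equiarboreal⇒noAscent {m} L equal x ∑y→0 ε 0<ε = k , eventually-map conclude (∣y∣≤B ⊗ ∑y→0 δ 0<δ)
  where
  κ = proj₁ (constant (λ e → count e L) equal)
  y : ℕ → Fin m → ℚ
  y i j = ∣ seq (x j) i ∣ - 1ℚ
  uniform = uniform-bound {s = y} λ j → cauchy (direction (λ _ → 1ℝ) x j)
  B = proj₁ uniform
  0≤B : 0ℚ ≤ B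
  0≤B = proj₁ (proj₂ uniform)
  ∣y∣≤B : Eventually (λ i → ∀ j → ∣ y i j ∣ ≤ B)
  ∣y∣≤B = proj₂ (proj₂ uniform)
  D = ι (length L) * quadratic B m
  0≤D : 0ℚ ≤ D
  0≤D = *-nonneg (ι-nonneg (length L)) (quadratic-nonneg m 0≤B)
  -- The summand `1ℚ` keeps the divisor positive when `A` is 0.
  room : ∀ {A} → 0ℚ ≤ A → ∃ λ δ → 0ℚ < δ × (A + 1ℚ) * δ ≡ ½ * ε
  room {A} 0≤A = shrink (A + 1ℚ) (nonNeg+pos⇒pos A {{nonNegative 0≤A}} 1ℚ) (½ * ε) (half-pos 0<ε)
  δ = proj₁ (room (ι-nonneg κ))
  0<δ : 0ℚ < δ
  0<δ = proj₁ (proj₂ (room (ι-nonneg κ)))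
  q = proj₁ (room 0≤D)
  0<q : 0ℚ < q
  0<q = proj₁ (proj₂ (room 0≤D))
  k = proj₁ (½^-small q 0<q)
  h = ½^ k
  0≤h : 0ℚ ≤ h
  0≤h = <⇒≤ (½^-pos k)
  f = ∑weight L

  Dh≤ : D * h ≤ ½ * ε
  Dh≤ = shrink-≤ 0≤D (<⇒≤ 0<q) (proj₂ (proj₂ (room 0≤D))) (proj₂ (½^-small q 0<q))

  ∑∑restrict≡ : ∀ y → ∑∑restrict L y ≡ ι κ * ∑ℚ y
  ∑∑restrict≡ y = trans (∑∑restrict-count L y) (trans
    (∑ℚ-cong λ e → cong (λ c → ι c * y e) (proj₂ (constant (λ e → count e L) equal) e)) (∑ℚ-* (ι κ) y))

  conclude : ∀ {i} → (∀ j → ∣ y i j ∣ ≤ B) × ∣ ∑ℚ (y i) ∣ < δ →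
    f (segment (λ _ → 1ℚ) (∣samples∣ x i) h) ≤ f (λ _ → 1ℚ) + ε * h
  conclude {i} (≤B , ∑y<δ) = begin
    f (λ j → 1ℚ + h * y i j)
      ≤⟨ ∑weight-expansion L ≤B 0≤B 0≤h (½^≤1 k)
           (segment-nonneg (λ _ → nonNegative⁻¹ 1ℚ) (λ j → 0≤∣p∣ (seq (x j) i)) 0≤h (½^≤1 k)) ⟩
    f (λ _ → 1ℚ) + h * ∑∑restrict L (y i) + sq h * D
      ≡⟨ cong (λ u → f (λ _ → 1ℚ) + h * u + sq h * D) (∑∑restrict≡ (y i)) ⟩
    f (λ _ → 1ℚ) + h * (ι κ * ∑ℚ (y i)) + sq h * D
      ≡⟨ solve 4 (λ w h u D → w :+ h :* u :+ h :* h :* D := w :+ h :* (u :+ D :* h)) refl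
           (f (λ _ → 1ℚ)) h (ι κ * ∑ℚ (y i)) D ⟩
    f (λ _ → 1ℚ) + h * (ι κ * ∑ℚ (y i) + D * h)
      ≤⟨ +-monoʳ-≤ (f (λ _ → 1ℚ)) (*-monoˡ-≤-nonNeg h {{nonNegative 0≤h}} (+-mono-≤
           (shrink-≤ (ι-nonneg κ) (<⇒≤ 0<δ) (proj₂ (proj₂ (room (ι-nonneg κ))))
             (≤-trans (p≤∣p∣ (∑ℚ (y i))) (<⇒≤ ∑y<δ))) Dh≤)) ⟩
    f (λ _ → 1ℚ) + h * (½ * ε + ½ * ε)
      ≡⟨ cong (λ u → f (λ _ → 1ℚ) + u) (trans (cong (h *_) (halves ε)) (*-comm h ε)) ⟩
    f (λ _ → 1ℚ) + ε * h ∎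
    where open ≤-Reasoning

∑ℚ-1 : ∀ m → ∑ℚ {m} (λ _ → 1ℚ) ≡ ι m
∑ℚ-1 zero    = refl
∑ℚ-1 (suc m) = cong (1ℚ +_) (∑ℚ-1 m)

ω∈EdgePolytope : ∀ G → EdgePolytope G (ω G)
ω∈EdgePolytope G = (λ j ε 0<ε → 0 , λ _ _ → +-nonneg (nonNegative⁻¹ 1ℚ) (<⇒≤ 0<ε)) ,
  λ ε 0<ε → 0 , λ i _ → subst (_< ε) (sym (cong ∣_∣ (trans
    (cong (_- (ℤ.+ #E / 1)) (trans (seq-∑ (ω G) i) (trans (∑ℚ-1 #E) (ι≡/1 #E)))) (+-inverseʳ (ℤ.+ #E / 1))))) 0<ε
  where open Graph G

direction-∑≈0 : ∀ {z x : Vector ℝ m} {s} → (∀ j → 0ℝ ℝ.≤ x j) → ∑ x ℝ.≈ s → ∑ z ℝ.≈ s → ∑ (direction z x) ℝ.≈ 0ℝ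
direction-∑≈0 {z = z} {x} {s} 0≤x ∑x≈s ∑z≈s = null-cong
  (λ i → trans (sym (seq-∑ (direction z x) i)) (sym (+-identityʳ (seq (∑ (direction z x)) i))))
  (direction-null {z = z} {x} {s} 0≤x ∑x≈s ∑z≈s)

corollary2p5 : (G : Graph) → Connected G →
    (∀ z → Interior G z → IsCritical G z → IsGlobalMax G z) ×
    (Equiarboreal G → IsGlobalMax G (ω G))
corollary2p5 G _ = critical-max , equiarboreal-max
  where
  open Graph G
  L = spanningTrees G

  log-concave : LogConcave (∑weight L)
  log-concave = trees-log-concave ends (isSpanningTree? G) (spanningTree⇔Tree G)

  critical-max : ∀ z → Interior G z → IsCritical G z → IsGlobalMax G z
  critical-max z (z∈P@(_ , ∑z) , 0<z) (_ , critical) = z∈P , λ x (0≤x , ∑x) →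
    noAscent⇒treeSum≤ L log-concave {z} {x} 0<z (critical⇒noAscent L {z} {x}
      (critical (direction z x) (direction-∑≈0 {z = z} {x} {fromℕ #E} 0≤x ∑x ∑z)))

  equiarboreal-max : Equiarboreal G → IsGlobalMax G (ω G)
  equiarboreal-max equal = ω∈EdgePolytope G , λ x (0≤x , ∑x) →
    noAscent⇒treeSum≤ L log-concave {ω G} {x} (λ _ → 0<fromℚ (positive⁻¹ 1ℚ))
      (equiarboreal⇒noAscent L equal x
        (direction-null {z = ω G} {x} {fromℕ #E} 0≤x ∑x (proj₂ (ω∈EdgePolytope G))))
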